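{- Let $G$ and $H$ be controllable graphs. Then the following four conditions are equivalent: (1) $G$ and $H$ have the same iterated degree sequence; (2) $G$ and $H$ are fractionally isomorphic; (3) $G$ and $H$ are $C^2$-equivalent; (4) $G$ and $H$ are isomorphic.
   Context: All graphs are finite and simple. For a graph $G$ on $n$ vertices with adjacency matrix $A$, let $\mathbf{1}$ be the all-ones vector in $\mathbb{R}^n$. The walk matrix of $G$ is the $n\times n$ matrix $W_G=\big[\mathbf{1}\ \ A\mathbf{1}\ \cdots\ A^{n-1}\mathbf{1}\big]$. The graph $G$ is controllable if $W_G$ is invertible. Iterated degree sequence: for a vertex $v$ of $G$, let $d(v)$ be its degree and $N(v)$ the set of vertices adjacent to $v$. Define inductively $d_0(v)=d(v)$ and $d_{r+1}(v)=\{d_r(u): u\in N(v)\}$ (a multiset) for $r\ge 0$. Define $d_0(G)=\{d(v): v\in V(G)\}$ (a multiset) and $d_{r+1}(G)=\{d_r(v): v\in V(G)\}$ (a multiset) for $r\ge 0$. The iterated degree sequence of $G$ is the sequence $D(G)=(d_r(G))_{r\ge 0}$. Fractional isomorphism: a real square matrix is doubly stochastic if all its entries are non-negative and every row and every column sums to $1$. Graphs $G$ and $H$ with adjacency matrices $A$ and $B$ are fractionally isomorphic if there exists a doubly stochastic matrix $S$ such that $SA=BS$ (in particular $G$ and $H$ have the same number of vertices). $C^2$-equivalence: $C^2$ is the fragment of first-order logic with counting quantifiers, in the language of graphs, whose formulas use at most two distinct variables (each of which may be re-quantified). Formulas are built from atomic formulas $x=y$ and $Exy$ (adjacency), with variables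 ranging over vertices, using negation, disjunction (and the usual derived connectives), the quantifier $\exists$ (and the derived $\forall$), and for each non-negative integer $d$ the counting quantifier $\exists^{\ge d}$, where $\exists^{\ge d}x\,\phi$ holds in a graph if there are at least $d$ distinct vertices which can be substituted for $x$ to make $\phi$ true. A sentence is a formula without free variables. Two graphs $G$ and $H$ are $C^2$-equivalent if, for every $C^2$-sentence $\phi$, $G\models\phi$ if and only if $H\models\phi$. -}

module Defs where

open import Algebra.Bundles.Raw using (RawMonoid)
import Algebra.Definitions.RawMonoid as RawMonoidDefinitions
open import Data.Bool.Base using (Bool; true; false; if_then_else_)
open import Data.Empty using (⊥-elim)
open import Data.Fin.Base using (Fin; toℕ)
import Data.Fin.Properties as Fin
open import Data.List.Base using (List; length; map; filterᵇ; allFin)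
import Data.List.Relation.Binary.Permutation.Setoid as Permutation
open import Data.Nat.Base as ℕ using (ℕ; zero; suc)
import Data.Nat.Properties as ℕ
open import Data.Product.Base using (Σ; ∃; _×_; _,_)
open import Data.Rational.Base as ℚ using (ℚ; 0ℚ; 1ℚ; ½; 1/_; ∣_∣; Positive; positive)
import Data.Rational.Properties as ℚ
open import Data.Rational.Solver using (module +-*-Solver)
open import Data.Sum.Base using (_⊎_; inj₁; inj₂)
open import Data.Vec.Functional using (Vector)
open import Function.Base using (_∘_)
open import Function.Bundles using (_⇔_; _↔_; _↣_; Inverse; Injection)
open import Level using (0ℓ)
open import Relation.Binary.Bundles using (Setoid)
open import Relation.Binary.PropositionalEquality
  using (_≡_; _≢_; refl; sym; trans; cong; cong₂; setoid)
open import Relation.Nullary using (¬_; yes; no)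

------------------------------------------------------------------------
-- Real numbers: Cauchy sequences of rationals, up to a setoid equality

record ℝ : Set where
  constructor mkℝ
  field
    seq    : ℕ → ℚ
    cauchy : ∀ ε → 0ℚ ℚ.< ε →
             ∃ λ N → ∀ m n → N ℕ.≤ m → N ℕ.≤ n → ∣ seq m ℚ.- seq n ∣ ℚ.≤ ε

open ℝ public

infix 4 _≈_ _≤_

_≈_ : ℝ → ℝ → Set
x ≈ y = ∀ ε → 0ℚ ℚ.< ε → ∃ λ N → ∀ n → N ℕ.≤ n → ∣ seq x n ℚ.- seq y n ∣ ℚ.≤ ε

_≤_ : ℝ → ℝ → Set
x ≤ y = ∀ ε → 0ℚ ℚ.< ε → ∃ λ N → ∀ n → N ℕ.≤ n → seq x n ℚ.≤ seq y n ℚ.+ ε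

fromℚ : ℚ → ℝ
fromℚ q = mkℝ (λ _ → q) λ ε 0<ε →
  0 , λ _ _ _ _ → ℚ.≤-trans (ℚ.≤-reflexive (cong ∣_∣ (ℚ.+-inverseʳ q))) (ℚ.<⇒≤ 0<ε)

0ℝ 1ℝ : ℝ
0ℝ = fromℚ 0ℚ
1ℝ = fromℚ 1ℚ

private
  half-positive : ∀ {ε} → 0ℚ ℚ.< ε → Positive (ε ℚ.* ½)
  half-positive {ε} 0<ε = ℚ.pos*pos⇒pos ε {{positive 0<ε}} ½

  half+half : ∀ ε → ε ℚ.* ½ ℚ.+ ε ℚ.* ½ ≡ ε
  half+half ε = trans (sym (ℚ.*-distribˡ-+ ε ½ ½)) (ℚ.*-identityʳ ε)

  module _ where
    open +-*-Solver

    +-rearrange : ∀ a b c d → (a ℚ.+ b) ℚ.- (c ℚ.+ d) ≡ (a ℚ.- c) ℚ.+ (b ℚ.- d)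
    +-rearrange = solve 4 (λ a b c d → (a :+ b) :- (c :+ d) := (a :- c) :+ (b :- d)) refl

    *-rearrange : ∀ a b c d → a ℚ.* b ℚ.- c ℚ.* d ≡ a ℚ.* (b ℚ.- d) ℚ.+ (a ℚ.- c) ℚ.* d
    *-rearrange = solve 4 (λ a b c d → a :* b :- c :* d := a :* (b :- d) :+ (a :- c) :* d) refl

    add-sub : ∀ a b → a ≡ (a ℚ.- b) ℚ.+ b
    add-sub = solve 2 (λ a b → a := (a :- b) :+ b) refl

  *-mono-≤-abs : ∀ p q {r s} → ∣ p ∣ ℚ.≤ r → ∣ q ∣ ℚ.≤ s → ∣ p ℚ.* q ∣ ℚ.≤ r ℚ.* s
  *-mono-≤-abs p q {r} {s} p≤r q≤s = begin
    ∣ p ℚ.* q ∣       ≡⟨ ℚ.∣p*q∣≡∣p∣*∣q∣ p q ⟩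
    ∣ p ∣ ℚ.* ∣ q ∣   ≤⟨ ℚ.*-monoʳ-≤-nonNeg ∣ q ∣ {{ℚ.∣-∣-nonNeg q}} p≤r ⟩
    r ℚ.* ∣ q ∣       ≤⟨ ℚ.*-monoˡ-≤-nonNeg r {{r≥0}} q≤s ⟩
    r ℚ.* s           ∎
    where
      open ℚ.≤-Reasoning
      r≥0 = ℚ.nonNegative (ℚ.≤-trans (ℚ.0≤∣p∣ p) p≤r)

  bounded : ∀ x → ∃ λ B → Positive B × ∃ λ N → ∀ n → N ℕ.≤ n → ∣ seq x n ∣ ℚ.≤ B
  bounded x with cauchy x 1ℚ (ℚ.positive⁻¹ 1ℚ)
  ... | N , close =
    1ℚ ℚ.+ ∣ seq x N ∣ ,
    ℚ.pos+nonNeg⇒pos 1ℚ ∣ seq x N ∣ {{ℚ.∣-∣-nonNeg (seq x N)}} ,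
    N , λ n N≤n → begin
      ∣ seq x n ∣
        ≡⟨ cong ∣_∣ (add-sub (seq x n) (seq x N)) ⟩
      ∣ (seq x n ℚ.- seq x N) ℚ.+ seq x N ∣
        ≤⟨ ℚ.∣p+q∣≤∣p∣+∣q∣ (seq x n ℚ.- seq x N) (seq x N) ⟩
      ∣ seq x n ℚ.- seq x N ∣ ℚ.+ ∣ seq x N ∣
        ≤⟨ ℚ.+-monoˡ-≤ ∣ seq x N ∣ (close n N N≤n ℕ.≤-refl) ⟩
      1ℚ ℚ.+ ∣ seq x N ∣ ∎
    where open ℚ.≤-Reasoning

  -- The tolerance for one factor of a product whose other factor is bounded by B.
  scale : ∀ ε B → 0ℚ ℚ.< ε → Positive B → ∃ λ δ → 0ℚ ℚ.< δ × B ℚ.* δ ≡ ε ℚ.* ½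
  scale ε B 0<ε B>0 =
    let instance
          _ = B>0
          _ = ℚ.pos⇒nonZero B
          _ = ℚ.1/pos⇒pos B
          _ = half-positive 0<ε
    in
    1/ B ℚ.* (ε ℚ.* ½) ,
    ℚ.positive⁻¹ _ {{ℚ.pos*pos⇒pos (1/ B) (ε ℚ.* ½)}} ,
    trans (sym (ℚ.*-assoc B (1/ B) (ε ℚ.* ½)))
      (trans (cong (ℚ._* (ε ℚ.* ½)) (ℚ.*-inverseʳ B)) (ℚ.*-identityˡ (ε ℚ.* ½)))

  Within : (ℕ → ℚ) → ℚ → ℕ → Set
  Within s ε N = ∀ m n → N ℕ.≤ m → N ℕ.≤ n → ∣ s m ℚ.- s n ∣ ℚ.≤ ε

  within-+ : ∀ {s t ε M N} → Within s (ε ℚ.* ½) M → Within t (ε ℚ.* ½) N →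
             Within (λ n → s n ℚ.+ t n) ε (M ℕ.⊔ N)
  within-+ {s} {t} {ε} {M} {N} s-close t-close m n ≤m ≤n = begin
    ∣ (s m ℚ.+ t m) ℚ.- (s n ℚ.+ t n) ∣
      ≡⟨ cong ∣_∣ (+-rearrange (s m) (t m) (s n) (t n)) ⟩
    ∣ (s m ℚ.- s n) ℚ.+ (t m ℚ.- t n) ∣
      ≤⟨ ℚ.∣p+q∣≤∣p∣+∣q∣ (s m ℚ.- s n) (t m ℚ.- t n) ⟩
    ∣ s m ℚ.- s n ∣ ℚ.+ ∣ t m ℚ.- t n ∣
      ≤⟨ ℚ.+-mono-≤ (s-close m n (ℕ.m⊔n≤o⇒m≤o M N ≤m) (ℕ.m⊔n≤o⇒m≤o M N ≤n))
                    (t-close m n (ℕ.m⊔n≤o⇒n≤o M N ≤m) (ℕ.m⊔n≤o⇒n≤o M N ≤n)) ⟩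
    ε ℚ.* ½ ℚ.+ ε ℚ.* ½
      ≡⟨ half+half ε ⟩
    ε ∎
    where open ℚ.≤-Reasoning

  within-* : ∀ {s t ε B C δs δt K L M N} →
             (∀ n → K ℕ.≤ n → ∣ s n ∣ ℚ.≤ B) → (∀ n → L ℕ.≤ n → ∣ t n ∣ ℚ.≤ C) →
             C ℚ.* δs ≡ ε ℚ.* ½ → B ℚ.* δt ≡ ε ℚ.* ½ →
             Within s δs M → Within t δt N →
             Within (λ n → s n ℚ.* t n) ε ((K ℕ.⊔ L) ℕ.⊔ (M ℕ.⊔ N))
  within-* {s} {t} {ε} {B} {C} {δs} {δt} {K} {L} {M} {N}
           s-bound t-bound C*δs≡½ε B*δt≡½ε s-close t-close m n ≤m ≤n = begin
    ∣ s m ℚ.* t m ℚ.- s n ℚ.* t n ∣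
      ≡⟨ cong ∣_∣ (*-rearrange (s m) (t m) (s n) (t n)) ⟩
    ∣ s m ℚ.* (t m ℚ.- t n) ℚ.+ (s m ℚ.- s n) ℚ.* t n ∣
      ≤⟨ ℚ.∣p+q∣≤∣p∣+∣q∣ (s m ℚ.* (t m ℚ.- t n)) ((s m ℚ.- s n) ℚ.* t n) ⟩
    ∣ s m ℚ.* (t m ℚ.- t n) ∣ ℚ.+ ∣ (s m ℚ.- s n) ℚ.* t n ∣
      ≤⟨ ℚ.+-mono-≤
           (*-mono-≤-abs (s m) (t m ℚ.- t n)
             (s-bound m (ℕ.m⊔n≤o⇒m≤o K L (K⊔L≤ ≤m)))
             (t-close m n (ℕ.m⊔n≤o⇒n≤o M N (M⊔N≤ ≤m)) (ℕ.m⊔n≤o⇒n≤o M N (M⊔N≤ ≤n))))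
           (*-mono-≤-abs (s m ℚ.- s n) (t n)
             (s-close m n (ℕ.m⊔n≤o⇒m≤o M N (M⊔N≤ ≤m)) (ℕ.m⊔n≤o⇒m≤o M N (M⊔N≤ ≤n)))
             (t-bound n (ℕ.m⊔n≤o⇒n≤o K L (K⊔L≤ ≤n)))) ⟩
    B ℚ.* δt ℚ.+ δs ℚ.* C
      ≡⟨ cong₂ ℚ._+_ B*δt≡½ε (trans (ℚ.*-comm δs C) C*δs≡½ε) ⟩
    ε ℚ.* ½ ℚ.+ ε ℚ.* ½
      ≡⟨ half+half ε ⟩
    ε ∎
    where
      open ℚ.≤-Reasoning
      K⊔L≤ : ∀ {k} → (K ℕ.⊔ L) ℕ.⊔ (M ℕ.⊔ N) ℕ.≤ k → K ℕ.⊔ L ℕ.≤ k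
      K⊔L≤ = ℕ.m⊔n≤o⇒m≤o (K ℕ.⊔ L) (M ℕ.⊔ N)
      M⊔N≤ : ∀ {k} → (K ℕ.⊔ L) ℕ.⊔ (M ℕ.⊔ N) ℕ.≤ k → M ℕ.⊔ N ℕ.≤ k
      M⊔N≤ = ℕ.m⊔n≤o⇒n≤o (K ℕ.⊔ L) (M ℕ.⊔ N)

  -- Abstract only to keep type checking fast: no other definition depends on the moduli.
  abstract
    cauchy-+ : ∀ x y ε → 0ℚ ℚ.< ε → ∃ (Within (λ n → seq x n ℚ.+ seq y n) ε)
    cauchy-+ x y ε 0<ε =
      let 0<½ε = ℚ.positive⁻¹ (ε ℚ.* ½) {{half-positive 0<ε}}
          _ , x-close = cauchy x (ε ℚ.* ½) 0<½ε
          _ , y-close = cauchy y (ε ℚ.* ½) 0<½ε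
      in _ , within-+ {seq x} {seq y} x-close y-close

    cauchy-* : ∀ x y ε → 0ℚ ℚ.< ε → ∃ (Within (λ n → seq x n ℚ.* seq y n) ε)
    cauchy-* x y ε 0<ε =
      let B , B>0 , _ , x-bound = bounded x
          C , C>0 , _ , y-bound = bounded y
          δx , 0<δx , C*δx≡½ε = scale ε C 0<ε C>0
          δy , 0<δy , B*δy≡½ε = scale ε B 0<ε B>0
          _ , x-close = cauchy x δx 0<δx
          _ , y-close = cauchy y δy 0<δy
      in _ , within-* {seq x} {seq y} x-bound y-bound C*δx≡½ε B*δy≡½ε x-close y-close

infixl 6 _+_
infixl 7 _*_

_+_ : ℝ → ℝ → ℝ
x + y = mkℝ (λ n → seq x n ℚ.+ seq y n) (cauchy-+ x y)

_*_ : ℝ → ℝ → ℝ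
x * y = mkℝ (λ n → seq x n ℚ.* seq y n) (cauchy-* x y)

+-0-rawMonoid : RawMonoid 0ℓ 0ℓ
+-0-rawMonoid = record { Carrier = ℝ ; _≈_ = _≈_ ; _∙_ = _+_ ; ε = 0ℝ }

open RawMonoidDefinitions +-0-rawMonoid public using (sum)

------------------------------------------------------------------------
-- Real matrices

Matrix : ℕ → ℕ → Set
Matrix m n = Fin m → Fin n → ℝ

infix 4 _≋_
infixl 7 _⊡_ _⊡ᵥ_
infixr 8 _^_

_≋_ : ∀ {m n} → Matrix m n → Matrix m n → Set
A ≋ B = ∀ i j → A i j ≈ B i j

_⊡_ : ∀ {l m n} → Matrix l m → Matrix m n → Matrix l n
(A ⊡ B) i j = sum λ k → A i k * B k j

_⊡ᵥ_ : ∀ {m n} → Matrix m n → Vector ℝ n → Vector ℝ m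
(A ⊡ᵥ v) i = sum λ k → A i k * v k

identity : ∀ n → Matrix n n
identity n i j with i Fin.≟ j
... | yes _ = 1ℝ
... | no  _ = 0ℝ

_^_ : ∀ {n} → Matrix n n → ℕ → Matrix n n
A ^ zero  = identity _
A ^ suc k = A ⊡ A ^ k

𝟏 : ∀ {n} → Vector ℝ n
𝟏 _ = 1ℝ

Invertible : ∀ {n} → Matrix n n → Set
Invertible {n} A = ∃ λ (B : Matrix n n) → A ⊡ B ≋ identity n × B ⊡ A ≋ identity n

record DoublyStochastic {n} (S : Matrix n n) : Set where
  field
    nonNegative : ∀ i j → 0ℝ ≤ S i j
    rowSum      : ∀ i → sum (λ j → S i j) ≈ 1ℝ
    columnSum   : ∀ j → sum (λ i → S i j) ≈ 1ℝ

------------------------------------------------------------------------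
-- Finite simple graphs, with vertex set Fin n

record Graph (n : ℕ) : Set where
  field
    adj       : Fin n → Fin n → Bool
    symmetric : ∀ u v → adj u v ≡ adj v u
    loopless  : ∀ v → adj v v ≡ false

open Graph public

record _≅_ {m n} (G : Graph m) (H : Graph n) : Set where
  field
    bijection : Fin m ↔ Fin n
    preserves : ∀ u v → adj G u v ≡ adj H (Inverse.to bijection u) (Inverse.to bijection v)

------------------------------------------------------------------------
-- Controllability

adjacencyMatrix : ∀ {n} → Graph n → Matrix n n
adjacencyMatrix G u v = if adj G u v then 1ℝ else 0ℝ

walkMatrix : ∀ {n} → Graph n → Matrix n n
walkMatrix G v j = (adjacencyMatrix G ^ toℕ j ⊡ᵥ 𝟏) v

Controllable : ∀ {n} → Graph n → Set
Controllable G = Invertible (walkMatrix G)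

------------------------------------------------------------------------
-- Iterated degree sequence

-- A finite multiset over S is a list of elements of S, up to permutation and
-- up to the equality of S on elements.
multisetSetoid : Setoid 0ℓ 0ℓ → Setoid 0ℓ 0ℓ
multisetSetoid S = Permutation.↭-setoid S

-- r-fold iterated multisets of natural numbers.
iteratedMultisetSetoid : ℕ → Setoid 0ℓ 0ℓ
iteratedMultisetSetoid zero    = setoid ℕ
iteratedMultisetSetoid (suc r) = multisetSetoid (iteratedMultisetSetoid r)

IteratedMultiset : ℕ → Set
IteratedMultiset r = Setoid.Carrier (iteratedMultisetSetoid r)

neighbours : ∀ {n} → Graph n → Fin n → List (Fin n)
neighbours {n} G v = filterᵇ (adj G v) (allFin n)

degree : ∀ {n} → Graph n → Fin n → ℕ
degree G v = length (neighbours G v)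

iteratedDegree : ∀ {n} → Graph n → ∀ r → Fin n → IteratedMultiset r
iteratedDegree G zero    v = degree G v
iteratedDegree G (suc r) v = map (iteratedDegree G r) (neighbours G v)

-- d₀(G) and d₁(G) are both the multiset of the degrees of G, so the nesting
-- depth of d_r(G) is 1, 1, 2, 3, …
depth : ℕ → ℕ
depth zero    = 1
depth (suc r) = suc r

iteratedDegreeSequence : ∀ {n} → Graph n → ∀ r → IteratedMultiset (depth r)
iteratedDegreeSequence {n} G zero    = map (degree G) (allFin n)
iteratedDegreeSequence {n} G (suc r) = map (iteratedDegree G r) (allFin n)

SameIteratedDegreeSequence : ∀ {m n} → Graph m → Graph n → Set
SameIteratedDegreeSequence G H = ∀ r →
  Setoid._≈_ (iteratedMultisetSetoid (depth r))
    (iteratedDegreeSequence G r) (iteratedDegreeSequence H r)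

------------------------------------------------------------------------
-- Fractional isomorphism

-- The index of the constructor forces G and H to have the same order.
data FractionallyIsomorphic {m} (G : Graph m) : ∀ {n} → Graph n → Set where
  fractional : ∀ {H : Graph m} (S : Matrix m m) → DoublyStochastic S →
               S ⊡ adjacencyMatrix G ≋ adjacencyMatrix H ⊡ S →
               FractionallyIsomorphic G H

------------------------------------------------------------------------
-- The two-variable counting logic C²

Var : Set
Var = Fin 2

data Formula : Set where
  _≐_ : Var → Var → Formula
  E   : Var → Var → Formula
  ¬′_ : Formula → Formula
  _∨′_ : Formula → Formula → Formula
  ∃′  : Var → Formula → Formula
  ∃≥  : ℕ → Var → Formula → Formula

Free : Var → Formula → Set
Free z (x ≐ y)    = z ≡ x ⊎ z ≡ y
Free z (E x y)    = z ≡ x ⊎ z ≡ y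
Free z (¬′ φ)     = Free z φ
Free z (φ ∨′ ψ)   = Free z φ ⊎ Free z ψ
Free z (∃′ x φ)   = z ≢ x × Free z φ
Free z (∃≥ d x φ) = z ≢ x × Free z φ

Sentence : Formula → Set
Sentence φ = ∀ z → ¬ Free z φ

-- Assignments are defined on the free variables only, so that sentences can be
-- interpreted in the graph with no vertices.
Assignment : ℕ → Formula → Set
Assignment n φ = ∀ z → Free z φ → Fin n

extend : ∀ {n} x φ → (∀ z → z ≢ x × Free z φ → Fin n) → Fin n → Assignment n φ
extend x φ ρ v z z∈φ with z Fin.≟ x
... | yes _  = v
... | no z≢x = ρ z (z≢x , z∈φ)

Satisfies : ∀ {n} → Graph n → ∀ φ → Assignment n φ → Set
Satisfies G (x ≐ y)  ρ = ρ x (inj₁ refl) ≡ ρ y (inj₂ refl)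
Satisfies G (E x y)  ρ = adj G (ρ x (inj₁ refl)) (ρ y (inj₂ refl)) ≡ true
Satisfies G (¬′ φ)   ρ = ¬ Satisfies G φ ρ
Satisfies G (φ ∨′ ψ) ρ =
  Satisfies G φ (λ z → ρ z ∘ inj₁) ⊎ Satisfies G ψ (λ z → ρ z ∘ inj₂)
Satisfies {n} G (∃′ x φ) ρ = ∃ λ (v : Fin n) → Satisfies G φ (extend x φ ρ v)
Satisfies {n} G (∃≥ d x φ) ρ =
  Σ (Fin d ↣ Fin n) λ f → ∀ i → Satisfies G φ (extend x φ ρ (Injection.to f i))

Models : ∀ {n} → Graph n → ∀ φ → Sentence φ → Set
Models G φ closed = Satisfies G φ (λ z z∈φ → ⊥-elim (closed z z∈φ))

C²-Equivalent : ∀ {m n} → Graph m → Graph n → Set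
C²-Equivalent G H = ∀ φ (closed : Sentence φ) → Models G φ closed ⇔ Models H φ closed

{-# OPTIONS --safe #-}

-- Let w_k(v) be the number of walks of length k from v. Each of the three
-- equivalences preserves walk counts: for every vertex of one graph and every K
-- some vertex of the other has the same w_k for all k < K. Indeed
--   * d_r(v) determines w_k(v) for k ≤ r;
--   * "w_k(x) = c" is definable in C², a sum over neighbours being recovered from
--     the numbers of neighbours whose value reaches each threshold;
--   * if S is doubly stochastic and SA = BS, then S averages the counts of G to
--     those of H and its transpose averages them back, so
--     Σᵢⱼ Sᵢⱼ (w_k(j) - w_k(i))² = 0 and Sᵢⱼ > 0 forces w_k(i) = w_k(j).
-- In a controllable graph distinct vertices have distinct rows in the walk matrix,
-- so this matching of vertices is a bijection. Expanding w_{k+1}(v) as a sum of w_k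
-- over all vertices, the invertibility of the walk matrix then shows that it
-- preserves adjacency.
module Submission where

open import Defs hiding (_≈_; _≤_; _+_; _*_; sum; _≋_; _⊡_)
open import Algebra.Bundles using (CommutativeSemiring)
import Algebra.Properties.Semiring.Mult as SemiringMult
import Algebra.Properties.Semiring.Sum as SemiringSum
open import Data.Bool.Base using (Bool; true; false; if_then_else_; T)
open import Data.Bool.Properties using (T?; T-≡)
open import Data.Empty using (⊥-elim)
open import Data.Fin.Base using (Fin; zero; suc; toℕ; inject≤)
open import Data.Fin.Patterns using (0F; 1F)
open import Data.Fin.Permutation using (↔⇒≡)
import Data.Fin.Properties as Fin
open import Data.List.Base using (List; []; _∷_; map; filter; filterᵇ; tabulate; allFin; length; lookup)
open import Data.List.Membership.Propositional using (_∈_)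
open import Data.List.Membership.Propositional.Properties
  using (∈-allFin; ∈-filter⁺; ∈-filter⁻; ∈-map⁺; ∈-map⁻; ∈-lookup)
open import Data.List.Membership.Propositional.Properties.WithK using (unique∧set⇒bag)
import Data.List.Membership.Setoid.Properties as SetoidMembershipProperties
open import Data.List.Properties using (map-∘; map-cong; length-map; filter-accept; filter-reject)
open import Data.List.Relation.Binary.BagAndSetEquality using (∼bag⇒↭)
open import Data.List.Relation.Binary.Permutation.Propositional using (_↭_; ↭⇒↭ₛ)
open import Data.List.Relation.Binary.Permutation.Propositional.Properties using (↭-length)
import Data.List.Relation.Binary.Permutation.Setoid as Permutation
import Data.List.Relation.Binary.Permutation.Setoid.Properties as PermutationProperties
import Data.List.Relation.Binary.Pointwise as Pointwise
import Data.List.Relation.Unary.All as All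
open import Data.List.Relation.Unary.AllPairs using (_∷_)
open import Data.List.Relation.Unary.Any using (index)
open import Data.List.Relation.Unary.Any.Properties using (lookup-index)
open import Data.List.Relation.Unary.Unique.Propositional using (Unique)
import Data.List.Relation.Unary.Unique.Propositional.Properties as Unique
open import Data.Nat.Base as ℕ using (ℕ; zero; suc)
open import Data.Nat.ListAction using () renaming (sum to sumᴸ)
import Data.Nat.Properties as ℕ
import Data.Nat.Tactic.RingSolver as ℕ
open import Data.Product.Base using (Σ; ∃; _×_; _,_; proj₁; proj₂; uncurry)
open import Data.Rational.Base as ℚ using (ℚ; 0ℚ; 1ℚ; ½; 1/_; ∣_∣; Positive; positive)
import Data.Rational.Properties as ℚ
open import Data.Rational.Solver using (module +-*-Solver)
open import Data.Sum.Base as Sum using (_⊎_; inj₁; inj₂; [_,_]′)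
open import Data.Unit.Base using (⊤; tt)
open import Data.Vec.Functional using (Vector; removeAt)
open import Function.Base using (_∘_; id; flip)
open import Function.Bundles using (Inverse; Injection; Equivalence; mk⇔; mk↔ₛ′; mk↣; _⇔_; _↣_)
open import Function.Construct.Symmetry using (⇔-sym)
open import Function.Properties.Inverse using (↔-sym; ↔⇒↣)
open import Level using (0ℓ)
open import Relation.Binary.Bundles using (Setoid)
open import Relation.Binary.PropositionalEquality as ≡ using (_≡_; _≢_; refl; cong; cong₂)
open import Relation.Nullary using (¬_; Dec; yes; no; contradiction; ¬?)
open import Relation.Nullary.Decidable using (decidable-stable; from-no; map′)

-- Walk counts and their comparison between graphs.

walks : ∀ {n} → Graph n → ℕ → Fin n → ℕ
walks G zero    v = 1
walks G (suc k) v = sumᴸ (map (walks G k) (neighbours G v))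

-- One vertex `u` matches all lengths below `K`, but it may change with `K`: an iterated degree or a
-- formula sees only finitely many lengths. Two of these, one in each direction, replace the choice
-- of a bijection.
WalksDominated : ∀ {m n} → Graph m → Graph n → Set
WalksDominated G H = ∀ K v → ∃ λ u → ∀ k → k ℕ.< K → walks G k v ≡ walks H k u

-- The square of a difference, with the subtraction moved across because a semiring has none.
-- Lowering both numbers by one keeps their distance and takes `2 * a + 2 * b + 2` from each side,
-- in terms of the lowered numbers.
square-difference : ∀ a b → a ℕ.* a ℕ.+ b ℕ.* b ≡ (a ℕ.* b ℕ.+ b ℕ.* a) ℕ.+ ℕ.∣ a - b ∣ ℕ.* ℕ.∣ a - b ∣
square-difference zero    b    = cong (ℕ._+ b ℕ.* b) (≡.sym (ℕ.*-zeroʳ b))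
square-difference (suc a) zero = lemma (suc a)
  where
  lemma : ∀ a → a ℕ.* a ℕ.+ 0 ≡ (a ℕ.* 0 ℕ.+ 0) ℕ.+ a ℕ.* a
  lemma = ℕ.solve-∀
square-difference (suc a) (suc b) = begin
  suc a ℕ.* suc a ℕ.+ suc b ℕ.* suc b
    ≡⟨ expand a b ⟩
  (a ℕ.* a ℕ.+ b ℕ.* b) ℕ.+ (2 ℕ.* a ℕ.+ 2 ℕ.* b ℕ.+ 2)
    ≡⟨ cong (ℕ._+ (2 ℕ.* a ℕ.+ 2 ℕ.* b ℕ.+ 2)) (square-difference a b) ⟩
  (a ℕ.* b ℕ.+ b ℕ.* a) ℕ.+ d² ℕ.+ (2 ℕ.* a ℕ.+ 2 ℕ.* b ℕ.+ 2)
    ≡⟨ collect a b d² ⟩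
  (suc a ℕ.* suc b ℕ.+ suc b ℕ.* suc a) ℕ.+ d² ∎
  where
  open ≡.≡-Reasoning
  d² = ℕ.∣ a - b ∣ ℕ.* ℕ.∣ a - b ∣
  expand : ∀ a b → suc a ℕ.* suc a ℕ.+ suc b ℕ.* suc b ≡ (a ℕ.* a ℕ.+ b ℕ.* b) ℕ.+ (2 ℕ.* a ℕ.+ 2 ℕ.* b ℕ.+ 2)
  expand = ℕ.solve-∀
  collect : ∀ a b d → (a ℕ.* b ℕ.+ b ℕ.* a) ℕ.+ d ℕ.+ (2 ℕ.* a ℕ.+ 2 ℕ.* b ℕ.+ 2) ≡
                      (suc a ℕ.* suc b ℕ.+ suc b ℕ.* suc a) ℕ.+ d
  collect = ℕ.solve-∀

-- Linear algebra over an ordered semiring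

-- Cancellation stands in for subtraction, and `1≰0` is the only strict fact, the source of every
-- contradiction between scalars.
record IsOrdered (R : CommutativeSemiring 0ℓ 0ℓ)
                 (_≤_ : CommutativeSemiring.Carrier R → CommutativeSemiring.Carrier R → Set) : Set where
  open CommutativeSemiring R
  field
    ≈⇒≤         : ∀ {x y} → x ≈ y → x ≤ y
    ≤-trans     : ∀ {x y z} → x ≤ y → y ≤ z → x ≤ z
    +-mono-≤    : ∀ {x y u v} → x ≤ y → u ≤ v → (x + u) ≤ (y + v)
    +-cancelˡ-≤ : ∀ x {y z} → (x + y) ≤ (x + z) → y ≤ z
    0≤1         : 0# ≤ 1#
    1≰0         : ¬ (1# ≤ 0#)

-- Kept abstract in R: on ℝ itself _≈_ unfolds, and its arguments could not be inferred.
module LinearAlgebra (R : CommutativeSemiring 0ℓ 0ℓ)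
                     (_≤_ : CommutativeSemiring.Carrier R → CommutativeSemiring.Carrier R → Set)
                     (isOrdered : IsOrdered R _≤_) where

  open CommutativeSemiring R hiding (refl; zero)
  open CommutativeSemiring R using () renaming (refl to ≈-refl)
  open IsOrdered isOrdered
  open SemiringSum semiring renaming (sum-cong-≋ to sum-cong)
  open SemiringMult semiring renaming (_×_ to _·_)
  open import Relation.Binary.Reasoning.Setoid setoid

  Mat : ℕ → ℕ → Set
  Mat m n = Fin m → Fin n → Carrier

  ι : ℕ → Carrier
  ι n = n · 1#

  ⟦_⟧ : Bool → Carrier
  ⟦ b ⟧ = if b then 1# else 0#

  -- A property up to `≈` instead of a fixed matrix, so that `identity n` over `ℝ` can be supplied
  -- from outside.
  record IsIdentity {n} (I : Mat n n) : Set where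
    field
      diagonal    : ∀ i → I i i ≈ 1#
      offDiagonal : ∀ {i j} → i ≢ j → I i j ≈ 0#

  1≉0 : ¬ (1# ≈ 0#)
  1≉0 1≈0 = 1≰0 (≈⇒≤ 1≈0)

  sum-zero : ∀ {n} {f : Vector Carrier n} → (∀ i → f i ≈ 0#) → sum f ≈ 0#
  sum-zero {n} f≈0 = trans (sum-cong f≈0) (sum-replicate-zero n)

  sum-single : ∀ {n} (f : Vector Carrier n) i → (∀ {j} → i ≢ j → f j ≈ 0#) → sum f ≈ f i
  sum-single {suc n} f i f≈0 = begin
    sum f                     ≈⟨ sum-remove f ⟩
    f i + sum (removeAt f i)  ≈⟨ +-congˡ (sum-zero λ j → f≈0 (Fin.punchInᵢ≢i i j ∘ ≡.sym)) ⟩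
    f i + 0#                  ≈⟨ +-identityʳ (f i) ⟩
    f i                       ∎

  sum-identityˡ : ∀ {n} {I : Mat n n} → IsIdentity I →
                  ∀ i (f : Vector Carrier n) → sum (λ j → I i j * f j) ≈ f i
  sum-identityˡ {I = I} isId i f = trans
    (sum-single (λ j → I i j * f j) i λ {j} i≢j →
      trans (*-congʳ (offDiagonal i≢j)) (zeroˡ (f j)))
    (trans (*-congʳ (diagonal i)) (*-identityˡ (f i)))
    where open IsIdentity isId

  sum-identityʳ : ∀ {n} {I : Mat n n} → IsIdentity I →
                  ∀ j (f : Vector Carrier n) → sum (λ i → f i * I i j) ≈ f j
  sum-identityʳ {I = I} isId j f = trans
    (sum-single (λ i → f i * I i j) j λ {i} j≢i →
      trans (*-congˡ (offDiagonal (j≢i ∘ ≡.sym))) (zeroʳ (f i)))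
    (trans (*-congˡ (diagonal j)) (*-identityʳ (f j)))
    where open IsIdentity isId

  sum-assoc : ∀ {m n} (x : Vector Carrier m) (M : Mat m n) (y : Vector Carrier n) →
              sum (λ j → sum (λ i → x i * M i j) * y j) ≈ sum (λ i → x i * sum (λ j → M i j * y j))
  sum-assoc x M y = begin
    sum (λ j → sum (λ i → x i * M i j) * y j)    ≈⟨ sum-cong (λ j → *-distribʳ-sum (y j) (λ i → x i * M i j)) ⟩
    sum (λ j → sum (λ i → x i * M i j * y j))    ≈⟨ ∑-comm (λ j i → x i * M i j * y j) ⟩
    sum (λ i → sum (λ j → x i * M i j * y j))    ≈⟨ sum-cong (λ i → sum-cong (λ j → *-assoc (x i) (M i j) (y j))) ⟩
    sum (λ i → sum (λ j → x i * (M i j * y j)))  ≈⟨ sum-cong (λ i → *-distribˡ-sum (x i) (λ j → M i j * y j)) ⟨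
    sum (λ i → x i * sum (λ j → M i j * y j))    ∎

  -- Cancelling a matrix with a right inverse.

  module RightInverse {n} {W B I : Mat n n} (isId : IsIdentity I)
                      (WB≈I : ∀ i j → sum (λ k → W i k * B k j) ≈ I i j) where
    open IsIdentity isId

    -- Equal rows of `W` give equal rows of the product with `B`, which in column `v` would read 1 ≈
    -- 0. Equality in `Fin n` is decidable, so refuting `u ≢ v` is enough.
    rows-distinct : ∀ {u v} → (∀ k → W u k ≈ W v k) → u ≡ v
    rows-distinct {u} {v} Wu≈Wv = decidable-stable (u Fin.≟ v) λ u≢v → 1≉0 (begin
      1#                           ≈⟨ diagonal v ⟨
      I v v                        ≈⟨ WB≈I v v ⟨
      sum (λ k → W v k * B k v)    ≈⟨ sum-cong (λ k → *-congʳ (Wu≈Wv k)) ⟨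
      sum (λ k → W u k * B k v)    ≈⟨ WB≈I u v ⟩
      I u v                        ≈⟨ offDiagonal u≢v ⟩
      0#                           ∎)

    apply-inverse : ∀ (x : Vector Carrier n) j →
                    sum (λ k → sum (λ i → x i * W i k) * B k j) ≈ x j
    apply-inverse x j = begin
      sum (λ k → sum (λ i → x i * W i k) * B k j)  ≈⟨ sum-assoc x W (λ k → B k j) ⟩
      sum (λ i → x i * sum (λ k → W i k * B k j))  ≈⟨ sum-cong (λ i → *-congˡ (WB≈I i j)) ⟩
      sum (λ i → x i * I i j)                      ≈⟨ sum-identityʳ isId j x ⟩
      x j                                          ∎

    -- Multiplying the row vectors on the right by `B` undoes `W`.
    cancel : ∀ (x y : Vector Carrier n) →
             (∀ k → sum (λ i → x i * W i k) ≈ sum (λ i → y i * W i k)) → ∀ j → x j ≈ y j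
    cancel x y xW≈yW j = begin
      x j                                          ≈⟨ apply-inverse x j ⟨
      sum (λ k → sum (λ i → x i * W i k) * B k j)  ≈⟨ sum-cong (λ k → *-congʳ (xW≈yW k)) ⟩
      sum (λ k → sum (λ i → y i * W i k) * B k j)  ≈⟨ apply-inverse y j ⟩
      y j                                          ∎

  ⟦⟧-injective : ∀ {b c} → ⟦ b ⟧ ≈ ⟦ c ⟧ → b ≡ c
  ⟦⟧-injective {false} {false} _   = refl
  ⟦⟧-injective {false} {true}  0≈1 = contradiction (sym 0≈1) 1≉0
  ⟦⟧-injective {true}  {false} 1≈0 = contradiction 1≈0 1≉0
  ⟦⟧-injective {true}  {true}  _   = refl

  -- Stated for `tabulate g` because the induction passes to `g ∘ suc`; `allFin n` is the case
  -- `g = id`.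
  ι-sum-filterᵇ : ∀ {a} {A : Set a} {n} (f : A → ℕ) (p : A → Bool) (g : Fin n → A) →
                  ι (sumᴸ (map f (filterᵇ p (tabulate g)))) ≈
                  sum (λ i → ⟦ p (g i) ⟧ * ι (f (g i)))
  ι-sum-filterᵇ {n = zero}  f p g = ≈-refl
  ι-sum-filterᵇ {n = suc n} f p g with p (g zero)
  ... | true  = trans (×-homo-+ 1# (f (g zero)) _)
                  (+-cong (sym (*-identityˡ _)) (ι-sum-filterᵇ f p (g ∘ suc)))
  ... | false = trans (ι-sum-filterᵇ f p (g ∘ suc))
                  (trans (sym (+-identityˡ _)) (+-congʳ (sym (zeroˡ _))))

  ι-walks-suc : ∀ {n} (G : Graph n) k v →
                ι (walks G (suc k) v) ≈ sum (λ u → ⟦ adj G v u ⟧ * ι (walks G k u))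
  ι-walks-suc G k v = ι-sum-filterᵇ (walks G k) (adj G v) id

  ι-cong : ∀ {a b} → a ≡ b → ι a ≈ ι b
  ι-cong = ×-congˡ

  -- Averaging walk counts by an intertwining matrix.

  module Fractional {m n} (G : Graph m) (H : Graph n) (S : Mat n m)
    (rowSum : ∀ i → sum (λ j → S i j) ≈ 1#)
    (intertwines : ∀ i j → sum (λ k → S i k * ⟦ adj G k j ⟧) ≈ sum (λ k → ⟦ adj H i k ⟧ * S k j)) where

    -- With A and B the adjacency matrices of `G` and `H`, row sums give S𝟏 = 𝟏, and SA = BS moves
    -- one factor across `S` at each step, so S A^k 𝟏 = B^k S𝟏 = B^k 𝟏.
    averages-walks : ∀ k i → sum (λ j → S i j * ι (walks G k j)) ≈ ι (walks H k i)
    averages-walks zero i = begin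
      sum (λ j → S i j * (1# + 0#))  ≈⟨ sum-cong (λ j → trans (*-congˡ (+-identityʳ 1#)) (*-identityʳ (S i j))) ⟩
      sum (λ j → S i j)              ≈⟨ rowSum i ⟩
      1#                             ≈⟨ +-identityʳ 1# ⟨
      1# + 0#                        ∎
    averages-walks (suc k) i = begin
      sum (λ j → S i j * ι (walks G (suc k) j))
        ≈⟨ sum-cong (λ j → *-congˡ (ι-walks-suc G k j)) ⟩
      sum (λ j → S i j * sum (λ l → ⟦ adj G j l ⟧ * ι (walks G k l)))
        ≈⟨ sum-assoc (S i) (λ j l → ⟦ adj G j l ⟧) _ ⟨
      sum (λ l → sum (λ j → S i j * ⟦ adj G j l ⟧) * ι (walks G k l))
        ≈⟨ sum-cong (λ l → *-congʳ (intertwines i l)) ⟩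
      sum (λ l → sum (λ j → ⟦ adj H i j ⟧ * S j l) * ι (walks G k l))
        ≈⟨ sum-assoc (λ j → ⟦ adj H i j ⟧) S _ ⟩
      sum (λ j → ⟦ adj H i j ⟧ * sum (λ l → S j l * ι (walks G k l)))
        ≈⟨ sum-cong (λ j → *-congˡ (averages-walks k j)) ⟩
      sum (λ j → ⟦ adj H i j ⟧ * ι (walks H k j))
        ≈⟨ ι-walks-suc H k i ⟨
      ι (walks H (suc k) i) ∎

  -- Double sums weighted by a matrix.

  weightedSum : ∀ {m n} → Mat m n → Mat m n → Carrier
  weightedSum S f = sum λ i → sum λ j → S i j * f i j

  weightedSum-cong : ∀ {m n} (S : Mat m n) {f g} → (∀ i j → f i j ≈ g i j) →
                     weightedSum S f ≈ weightedSum S g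
  weightedSum-cong S f≈g = sum-cong λ i → sum-cong λ j → *-congˡ (f≈g i j)

  weightedSum-+ : ∀ {m n} (S f g : Mat m n) →
                  weightedSum S (λ i j → f i j + g i j) ≈ weightedSum S f + weightedSum S g
  weightedSum-+ S f g = trans
    (sum-cong λ i → trans (sum-cong λ j → distribˡ (S i j) (f i j) (g i j))
                          (∑-distrib-+ (λ j → S i j * f i j) (λ j → S i j * g i j)))
    (∑-distrib-+ (λ i → sum λ j → S i j * f i j) (λ i → sum λ j → S i j * g i j))

  -- The factor `p i` leaves the inner sum. The variance argument takes `g` constant 1 for the
  -- squares and `g` the walk counts for the cross products.
  weightedSum-rows : ∀ {m n} (S : Mat m n)
                     (p : Vector Carrier m) (g : Vector Carrier n) (s : Vector Carrier m) →
                     (∀ i → sum (λ j → S i j * g j) ≈ s i) →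
                     weightedSum S (λ i j → p i * g j) ≈ sum (λ i → p i * s i)
  weightedSum-rows S p g s Sg≈s = sum-cong λ i → begin
    sum (λ j → S i j * (p i * g j))  ≈⟨ sum-cong (λ j → x*yz≈y*xz (S i j) (p i) (g j)) ⟩
    sum (λ j → p i * (S i j * g j))  ≈⟨ *-distribˡ-sum (p i) (λ j → S i j * g j) ⟨
    p i * sum (λ j → S i j * g j)    ≈⟨ *-congˡ (Sg≈s i) ⟩
    p i * s i                        ∎
    where
    x*yz≈y*xz : ∀ x y z → x * (y * z) ≈ y * (x * z)
    x*yz≈y*xz x y z = trans (sym (*-assoc x y z)) (trans (*-congʳ (*-comm x y)) (*-assoc y x z))

  weightedSum-columns : ∀ {m n} (S : Mat m n)
                        (p : Vector Carrier n) (g : Vector Carrier m) (s : Vector Carrier n) →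
                        (∀ j → sum (λ i → S i j * g i) ≈ s j) →
                        weightedSum S (λ i j → p j * g i) ≈ sum (λ j → p j * s j)
  weightedSum-columns S p g s Sg≈s = trans (∑-comm (λ i j → S i j * (p j * g i)))
                                           (weightedSum-rows (flip S) p g s Sg≈s)

  -- Order properties of finite sums.

  ≤-refl : ∀ {x} → x ≤ x
  ≤-refl = ≈⇒≤ ≈-refl

  sum-≥0 : ∀ {n} {f : Vector Carrier n} → (∀ i → 0# ≤ f i) → 0# ≤ sum f
  sum-≥0 {zero}  f≥0 = ≤-refl
  sum-≥0 {suc n} f≥0 = ≤-trans (≈⇒≤ (sym (+-identityʳ 0#))) (+-mono-≤ (f≥0 zero) (sum-≥0 (f≥0 ∘ suc)))

  sum-≤0 : ∀ {n} {f : Vector Carrier n} → (∀ i → f i ≤ 0#) → sum f ≤ 0#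
  sum-≤0 {zero}  f≤0 = ≤-refl
  sum-≤0 {suc n} f≤0 = ≤-trans (+-mono-≤ (f≤0 zero) (sum-≤0 (f≤0 ∘ suc))) (≈⇒≤ (+-identityʳ 0#))

  x≤x+y : ∀ {x y} → 0# ≤ y → x ≤ (x + y)
  x≤x+y 0≤y = ≤-trans (≈⇒≤ (sym (+-identityʳ _))) (+-mono-≤ ≤-refl 0≤y)

  term≤sum : ∀ {n} {f : Vector Carrier n} → (∀ i → 0# ≤ f i) → ∀ i → f i ≤ sum f
  term≤sum f≥0 zero    = x≤x+y (sum-≥0 (f≥0 ∘ suc))
  term≤sum f≥0 (suc i) = ≤-trans (term≤sum (f≥0 ∘ suc) i)
    (≤-trans (x≤x+y (f≥0 zero)) (≈⇒≤ (+-comm _ _)))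

  -- `IsOrdered` has no rule for products, but multiplying by `ι n` is repeated addition.
  *ι-≥0 : ∀ {x} n → 0# ≤ x → 0# ≤ (x * ι n)
  *ι-≥0 {x} zero    0≤x = ≈⇒≤ (sym (zeroʳ x))
  *ι-≥0 {x} (suc n) 0≤x = ≤-trans 0≤x (≤-trans (x≤x+y (*ι-≥0 n 0≤x))
    (≈⇒≤ (trans (+-congʳ (sym (*-identityʳ x))) (sym (distribˡ x 1# (ι n))))))

  x≤x*ι[1+n] : ∀ {x} n → 0# ≤ x → x ≤ (x * ι (suc n))
  x≤x*ι[1+n] {x} n 0≤x = ≤-trans (x≤x+y (*ι-≥0 n 0≤x))
    (≈⇒≤ (trans (+-congʳ (sym (*-identityʳ x))) (sym (distribˡ x 1# (ι n)))))

  -- If S averages a to b and its transpose averages b to a, then expanding the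
  -- square gives Σᵢⱼ Sᵢⱼ (aⱼ - bᵢ)² = 0, so S vanishes wherever a and b differ.
  module Variance {m n} (S : Mat n m) (S≥0 : ∀ i j → 0# ≤ S i j)
    (rowSum : ∀ i → sum (λ j → S i j) ≈ 1#) (columnSum : ∀ j → sum (λ i → S i j) ≈ 1#)
    (a : Fin m → ℕ) (b : Fin n → ℕ)
    (S·a≈b : ∀ i → sum (λ j → S i j * ι (a j)) ≈ ι (b i))
    (b·S≈a : ∀ j → sum (λ i → S i j * ι (b i)) ≈ ι (a j)) where

    d² : Fin n → Fin m → ℕ
    d² i j = ℕ.∣ b i - a j ∣ ℕ.* ℕ.∣ b i - a j ∣

    α : Vector Carrier m
    α j = ι (a j)
    β : Vector Carrier n
    β i = ι (b i)

    -- The trailing `* 1#` gives the squares the shape `p i * g j` or `p j * g i` that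
    -- `weightedSum-rows` and `weightedSum-columns` expect.
    ι-square-difference : ∀ i j → β i * β i * 1# + α j * α j * 1# ≈ (β i * α j + α j * β i) + ι (d² i j)
    ι-square-difference i j = begin
      β i * β i * 1# + α j * α j * 1#
        ≈⟨ +-cong (trans (*-identityʳ _) (sym (×1-homo-* (b i) (b i))))
                  (trans (*-identityʳ _) (sym (×1-homo-* (a j) (a j)))) ⟩
      ι (b i ℕ.* b i) + ι (a j ℕ.* a j)
        ≈⟨ ×-homo-+ 1# (b i ℕ.* b i) (a j ℕ.* a j) ⟨
      ι (b i ℕ.* b i ℕ.+ a j ℕ.* a j)
        ≈⟨ ι-cong (square-difference (b i) (a j)) ⟩
      ι ((b i ℕ.* a j ℕ.+ a j ℕ.* b i) ℕ.+ d² i j)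
        ≈⟨ ×-homo-+ 1# (b i ℕ.* a j ℕ.+ a j ℕ.* b i) (d² i j) ⟩
      ι (b i ℕ.* a j ℕ.+ a j ℕ.* b i) + ι (d² i j)
        ≈⟨ +-congʳ (×-homo-+ 1# (b i ℕ.* a j) (a j ℕ.* b i)) ⟩
      (ι (b i ℕ.* a j) + ι (a j ℕ.* b i)) + ι (d² i j)
        ≈⟨ +-congʳ (+-cong (×1-homo-* (b i) (a j)) (×1-homo-* (a j) (b i))) ⟩
      (β i * α j + α j * β i) + ι (d² i j) ∎

    rows-1 : ∀ i → sum (λ j → S i j * 1#) ≈ 1#
    rows-1 i = trans (sum-cong λ j → *-identityʳ (S i j)) (rowSum i)

    columns-1 : ∀ j → sum (λ i → S i j * 1#) ≈ 1#
    columns-1 j = trans (sum-cong λ i → *-identityʳ (S i j)) (columnSum j)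

    cross = weightedSum S (λ i j → β i * α j + α j * β i)
    variance = weightedSum S (λ i j → ι (d² i j))

    variance-≈ : cross + variance ≈ cross + 0#
    variance-≈ = begin
      cross + variance
        ≈⟨ weightedSum-+ S (λ i j → β i * α j + α j * β i) (λ i j → ι (d² i j)) ⟨
      weightedSum S (λ i j → (β i * α j + α j * β i) + ι (d² i j))
        ≈⟨ weightedSum-cong S ι-square-difference ⟨
      weightedSum S (λ i j → β i * β i * 1# + α j * α j * 1#)
        ≈⟨ weightedSum-+ S (λ i j → β i * β i * 1#) (λ i j → α j * α j * 1#) ⟩
      weightedSum S (λ i j → β i * β i * 1#) + weightedSum S (λ i j → α j * α j * 1#)
        ≈⟨ +-cong (weightedSum-rows S (λ i → β i * β i) (λ _ → 1#) (λ _ → 1#) rows-1)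
                  (weightedSum-columns S (λ j → α j * α j) (λ _ → 1#) (λ _ → 1#) columns-1) ⟩
      sum (λ i → β i * β i * 1#) + sum (λ j → α j * α j * 1#)
        ≈⟨ +-cong (sum-cong λ i → *-identityʳ (β i * β i)) (sum-cong λ j → *-identityʳ (α j * α j)) ⟩
      sum (λ i → β i * β i) + sum (λ j → α j * α j)
        -- Averaging `a` along row `i` returns `b i`, and averaging `b` along column `j` returns
        -- `a j`, so the cross products have the same sums as the squares.
        ≈⟨ +-cong (weightedSum-rows S β α β S·a≈b) (weightedSum-columns S α β α b·S≈a) ⟨
      weightedSum S (λ i j → β i * α j) + weightedSum S (λ i j → α j * β i)
        ≈⟨ weightedSum-+ S (λ i j → β i * α j) (λ i j → α j * β i) ⟨
      cross
        ≈⟨ +-identityʳ cross ⟨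
      cross + 0# ∎

    variance≤0 : variance ≤ 0#
    variance≤0 = +-cancelˡ-≤ cross (≈⇒≤ variance-≈)

    vanishes : ∀ i j → a j ≢ b i → S i j ≤ 0#
    vanishes i j aj≢bi with d² i j in eq
    ... | zero  = contradiction (ℕ.∣m-n∣≡0⇒m≡n ([ id , id ]′ (ℕ.m*n≡0⇒m≡0∨n≡0 _ eq))) (aj≢bi ∘ ≡.sym)
    -- A non-zero square is at least 1, so `S i j` is at most its own term of `variance`, a sum of
    -- non-negative terms.
    ... | suc d = ≤-trans (x≤x*ι[1+n] d (S≥0 i j))
      (≤-trans (≈⇒≤ (*-congˡ (ι-cong (≡.sym eq))))
        (≤-trans (term≤sum (λ j → *ι-≥0 (d² i j) (S≥0 i j)) j)
          (≤-trans (term≤sum (λ i → sum-≥0 λ j → *ι-≥0 (d² i j) (S≥0 i j)) i) variance≤0)))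

  -- Transpose SA = BS and use that both adjacency matrices are symmetric.
  transpose-intertwines : ∀ {m n} (G : Graph m) (H : Graph n) (S : Mat n m) →
    (∀ i j → sum (λ k → S i k * ⟦ adj G k j ⟧) ≈ sum (λ k → ⟦ adj H i k ⟧ * S k j)) →
    ∀ j i → sum (λ k → S k j * ⟦ adj H k i ⟧) ≈ sum (λ k → ⟦ adj G j k ⟧ * S i k)
  transpose-intertwines G H S SA≈BS j i = begin
    sum (λ k → S k j * ⟦ adj H k i ⟧)  ≈⟨ sum-cong (λ k → swap-symmetric H (S k j) k i) ⟩
    sum (λ k → ⟦ adj H i k ⟧ * S k j)  ≈⟨ SA≈BS i j ⟨
    sum (λ k → S i k * ⟦ adj G k j ⟧)  ≈⟨ sum-cong (λ k → swap-symmetric G (S i k) k j) ⟩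
    sum (λ k → ⟦ adj G j k ⟧ * S i k)  ∎
    where
    swap-symmetric : ∀ {n} (G : Graph n) x u v → x * ⟦ adj G u v ⟧ ≈ ⟦ adj G v u ⟧ * x
    swap-symmetric G x u v = trans (*-comm x ⟦ adj G u v ⟧) (*-congʳ (reflexive (cong ⟦_⟧ (symmetric G u v))))

  -- If every `j` differed from `i` at some length below `K`, all of row `i` would be at most 0, yet
  -- it sums to 1. The witness comes from a finite search comparing natural numbers, so no sign of a
  -- real number has to be decided.
  fractional⇒dominated : ∀ {m n} (G : Graph m) (H : Graph n) (S : Mat n m) → (∀ i j → 0# ≤ S i j) →
    (∀ i → sum (λ j → S i j) ≈ 1#) → (∀ j → sum (λ i → S i j) ≈ 1#) →
    (∀ i j → sum (λ k → S i k * ⟦ adj G k j ⟧) ≈ sum (λ k → ⟦ adj H i k ⟧ * S k j)) →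
    WalksDominated H G
  fractional⇒dominated G H S S≥0 rowSum columnSum SA≈BS K i
    with Fin.any? (λ j → ℕ.allUpTo? (λ k → walks H k i ℕ.≟ walks G k j) K)
  ... | yes (j , same) = j , λ k → same {k}
  ... | no differ = contradiction (≤-trans (≈⇒≤ (sym (rowSum i))) (sum-≤0 row≤0)) 1≰0
    where
    row≤0 : ∀ j → S i j ≤ 0#
    row≤0 j with ℕ.anyUpTo? (λ k → ¬? (walks G k j ℕ.≟ walks H k i)) K
    ... | yes (k , _ , walks≢) = Variance.vanishes S S≥0 rowSum columnSum (walks G k) (walks H k)
            (Fractional.averages-walks G H S rowSum SA≈BS k)
            (Fractional.averages-walks H G (flip S) columnSum (transpose-intertwines G H S SA≈BS) k) i j walks≢
    ... | no same = contradiction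
            (j , λ {k} k<K → ≡.sym (decidable-stable (walks G k j ℕ.≟ walks H k i)
                                     λ walks≢ → same (k , k<K , walks≢)))
            differ

  -- The powers enter as a family with their recursion, because `_^_` is tied to `ℝ` while the
  -- scalars here are abstract.
  ι-walks-power : ∀ {n} (G : Graph n) (A^ : ℕ → Mat n n) → IsIdentity (A^ 0) →
    (∀ k i j → A^ (suc k) i j ≈ sum (λ l → ⟦ adj G i l ⟧ * A^ k l j)) →
    ∀ k i → sum (λ j → A^ k i j * 1#) ≈ ι (walks G k i)
  ι-walks-power G A^ isId step zero i = trans (sum-identityˡ isId i (λ _ → 1#)) (sym (+-identityʳ 1#))
  ι-walks-power G A^ isId step (suc k) i = begin
    sum (λ j → A^ (suc k) i j * 1#)
      ≈⟨ sum-cong (λ j → *-congʳ (step k i j)) ⟩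
    sum (λ j → sum (λ l → ⟦ adj G i l ⟧ * A^ k l j) * 1#)
      ≈⟨ sum-assoc (λ l → ⟦ adj G i l ⟧) (A^ k) (λ _ → 1#) ⟩
    sum (λ l → ⟦ adj G i l ⟧ * sum (λ j → A^ k l j * 1#))
      ≈⟨ sum-cong (λ l → *-congˡ (ι-walks-power G A^ isId step k l)) ⟩
    sum (λ l → ⟦ adj G i l ⟧ * ι (walks G k l))
      ≈⟨ ι-walks-suc G k i ⟨
    ι (walks G (suc k) i) ∎

  -- From matched walk counts to an isomorphism.

  record WalkInverse {n} (G : Graph n) : Set where
    field
      {I}        : Mat n n
      isIdentity : IsIdentity I
      B          : Mat n n
      WB≈I       : ∀ i j → sum (λ k → ι (walks G (toℕ k) i) * B k j) ≈ I i j

    open RightInverse isIdentity WB≈I public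

    -- The columns of the walk matrix hold the counts for lengths below `n`, hence below `K`, so the
    -- two vertices have equal rows.
    walks-distinct : ∀ {K} → n ℕ.≤ K → ∀ {u v} →
                     (∀ k → k ℕ.< K → walks G k u ≡ walks G k v) → u ≡ v
    walks-distinct n≤K same = rows-distinct λ k →
      ι-cong (same (toℕ k) (ℕ.<-≤-trans (Fin.toℕ<n k) n≤K))

  walkInverse : ∀ {n} {G : Graph n} (W : Mat n n) → (∀ i k → W i k ≈ ι (walks G (toℕ k) i)) →
                ∀ {I : Mat n n} → IsIdentity I → (B : Mat n n) →
                (∀ i j → sum (λ k → W i k * B k j) ≈ I i j) → WalkInverse G
  walkInverse W W≈walks isId B WB≈I = record
    { isIdentity = isId
    ; B          = B
    ; WB≈I       = λ i j → trans (sum-cong λ k → *-congʳ (sym (W≈walks i k))) (WB≈I i j) }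

  module Isomorphism {m n} {G : Graph m} {H : Graph n} (invᴳ : WalkInverse G) (invᴴ : WalkInverse H)
                     (G≼H : WalksDominated G H) (H≼G : WalksDominated H G) where

    -- `m + n` bounds both orders, not yet known to be equal; the extra one admits the length
    -- `suc (toℕ k)` in `same-sums`.
    K : ℕ
    K = suc (m ℕ.+ n)

    to : Fin m → Fin n
    to v = proj₁ (G≼H K v)

    from : Fin n → Fin m
    from u = proj₁ (H≼G K u)

    walks-to : ∀ v k → k ℕ.< K → walks G k v ≡ walks H k (to v)
    walks-to v = proj₂ (G≼H K v)

    walks-from : ∀ u k → k ℕ.< K → walks H k u ≡ walks G k (from u)
    walks-from u = proj₂ (H≼G K u)

    -- `u` and `to (from u)` both share their counts with `from u`, and counts below `K` separate
    -- the vertices of `H`.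
    to∘from : ∀ u → to (from u) ≡ u
    to∘from u = WalkInverse.walks-distinct invᴴ (ℕ.m≤n⇒m≤1+n (ℕ.m≤n+m n m)) λ k k<K →
      ≡.sym (≡.trans (walks-from u k k<K) (walks-to (from u) k k<K))

    from∘to : ∀ v → from (to v) ≡ v
    from∘to v = WalkInverse.walks-distinct invᴳ (ℕ.m≤n⇒m≤1+n (ℕ.m≤m+n m n)) λ k k<K →
      ≡.sym (≡.trans (walks-to v k k<K) (walks-from (to v) k k<K))

    bijection′ = mk↔ₛ′ to from to∘from from∘to

    -- Both sides count the walks of length k + 1, from `v` and from `to v`, the latter reindexed
    -- along the bijection. Thus row `v` of G and its image in H agree after multiplication by the
    -- walk matrix of `G`, which `cancel` removes.
    same-sums : ∀ v k → sum (λ i → ⟦ adj G v i ⟧ * ι (walks G (toℕ {m} k) i)) ≈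
                        sum (λ i → ⟦ adj H (to v) (to i) ⟧ * ι (walks G (toℕ k) i))
    same-sums v k = begin
      sum (λ i → ⟦ adj G v i ⟧ * ι (walks G (toℕ k) i))
        ≈⟨ ι-walks-suc G (toℕ k) v ⟨
      ι (walks G (suc (toℕ k)) v)
        ≈⟨ ι-cong (walks-to v (suc (toℕ k)) (ℕ.s≤s k<m+n)) ⟩
      ι (walks H (suc (toℕ k)) (to v))
        ≈⟨ ι-walks-suc H (toℕ k) (to v) ⟩
      sum (λ u → ⟦ adj H (to v) u ⟧ * ι (walks H (toℕ k) u))
        ≈⟨ ∑-permute (λ u → ⟦ adj H (to v) u ⟧ * ι (walks H (toℕ k) u)) bijection′ ⟩
      sum (λ i → ⟦ adj H (to v) (to i) ⟧ * ι (walks H (toℕ k) (to i)))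
        ≈⟨ sum-cong (λ i → *-congˡ (ι-cong (walks-to i (toℕ k) (ℕ.m<n⇒m<1+n k<m+n)))) ⟨
      sum (λ i → ⟦ adj H (to v) (to i) ⟧ * ι (walks G (toℕ k) i)) ∎
      where
      k<m+n : toℕ k ℕ.< m ℕ.+ n
      k<m+n = ℕ.<-≤-trans (Fin.toℕ<n k) (ℕ.m≤m+n m n)

    G≅H : G ≅ H
    G≅H = record
      { bijection = bijection′
      ; preserves = λ v i → ⟦⟧-injective (WalkInverse.cancel invᴳ
          (λ i → ⟦ adj G v i ⟧) (λ i → ⟦ adj H (to v) (to i) ⟧) (same-sums v) i) }

  -- The permutation matrix of an isomorphism.

  identity-≥0 : ∀ {n} {I : Mat n n} → IsIdentity I → ∀ i j → 0# ≤ I i j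
  identity-≥0 isId i j with i Fin.≟ j
  ... | yes refl = ≤-trans 0≤1 (≈⇒≤ (sym (IsIdentity.diagonal isId i)))
  ... | no  i≢j  = ≈⇒≤ (sym (IsIdentity.offDiagonal isId i≢j))

  module PermutationMatrix {m n} {G : Graph m} {H : Graph n} (G≅H : G ≅ H)
                           {I : Mat m m} (isId : IsIdentity I) where
    open _≅_ G≅H
    open Inverse bijection using (to; from; strictlyInverseˡ; strictlyInverseʳ)

    S : Mat n m
    S i j = I (from i) j

    S≥0 : ∀ i j → 0# ≤ S i j
    S≥0 i j = identity-≥0 isId (from i) j

    rowSum : ∀ i → sum (λ j → S i j) ≈ 1#
    rowSum i = trans (sum-cong λ j → sym (*-identityʳ (S i j))) (sum-identityˡ isId (from i) (λ _ → 1#))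

    columnSum : ∀ j → sum (λ i → S i j) ≈ 1#
    columnSum j = begin
      sum (λ i → I (from i) j)  ≈⟨ ∑-permute (λ i → I i j) (↔-sym bijection) ⟨
      sum (λ i → I i j)         ≈⟨ sum-cong (λ i → *-identityˡ (I i j)) ⟨
      sum (λ i → 1# * I i j)    ≈⟨ sum-identityʳ isId j (λ _ → 1#) ⟩
      1#                        ∎

    -- Each side collapses to one entry, `adj G (from i) j` and `adj H i (to j)`; the right-hand sum
    -- is first reindexed by `k = to l`.
    intertwines : ∀ i j → sum (λ k → S i k * ⟦ adj G k j ⟧) ≈ sum (λ k → ⟦ adj H i k ⟧ * S k j)
    intertwines i j = begin
      sum (λ k → I (from i) k * ⟦ adj G k j ⟧)
        ≈⟨ sum-identityˡ isId (from i) (λ k → ⟦ adj G k j ⟧) ⟩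
      ⟦ adj G (from i) j ⟧
        ≡⟨ cong ⟦_⟧ (≡.trans (preserves (from i) j) (cong (λ u → adj H u (to j)) (strictlyInverseˡ i))) ⟩
      ⟦ adj H i (to j) ⟧
        ≈⟨ sum-identityʳ isId j (λ l → ⟦ adj H i (to l) ⟧) ⟨
      sum (λ l → ⟦ adj H i (to l) ⟧ * I l j)
        ≡⟨ sum-cong-≗ (λ l → cong (λ x → ⟦ adj H i (to l) ⟧ * I x j) (strictlyInverseʳ l)) ⟨
      sum (λ l → ⟦ adj H i (to l) ⟧ * I (from (to l)) j)
        ≈⟨ ∑-permute (λ k → ⟦ adj H i k ⟧ * I (from k) j) bijection ⟨
      sum (λ k → ⟦ adj H i k ⟧ * I (from k) j) ∎

-- Iterated degree sequences

-- walks G k v depends only on d_r(v) as soon as k ≤ r; the value at a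
-- multiset of depth less than k is junk.
multisetWalks : ∀ r → ℕ → IteratedMultiset r → ℕ
multisetWalks r       zero    M = 1
multisetWalks zero    (suc k) M = 0
multisetWalks (suc r) (suc k) M = sumᴸ (map (multisetWalks r k) M)

-- A sum in a commutative monoid respects both the reordering of entries and their replacement by
-- equal multisets one level down.
multisetWalks-cong : ∀ r k {M N} → Setoid._≈_ (iteratedMultisetSetoid r) M N →
                     multisetWalks r k M ≡ multisetWalks r k N
multisetWalks-cong r       zero    M≈N = refl
multisetWalks-cong zero    (suc k) M≈N = refl
multisetWalks-cong (suc r) (suc k) M≈N =
  PermutationProperties.foldr-commMonoid (≡.setoid ℕ) ℕ.+-0-isCommutativeMonoid
    (PermutationProperties.map⁺ (iteratedMultisetSetoid r) (≡.setoid ℕ) (multisetWalks-cong r k) M≈N)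

multisetWalks-iteratedDegree : ∀ {n} (G : Graph n) r k → k ℕ.≤ r → ∀ v →
                               multisetWalks r k (iteratedDegree G r v) ≡ walks G k v
multisetWalks-iteratedDegree G r       zero    k≤r         v = refl
multisetWalks-iteratedDegree G (suc r) (suc k) (ℕ.s≤s k≤r) v = cong sumᴸ
  (≡.trans (≡.sym (map-∘ (neighbours G v)))
           (map-cong (multisetWalks-iteratedDegree G r k k≤r) (neighbours G v)))

sameIteratedDegrees⇒dominated : ∀ {m n} (G : Graph m) (H : Graph n) →
                                SameIteratedDegreeSequence G H → WalksDominated G H
sameIteratedDegrees⇒dominated {m} {n} G H same K v =
  let u , _ , d[v]≈d[u] = ∈-map⁻ₛ (≡.setoid (Fin n)) S
        -- The graph-level multiset at index `suc K` collects the vertex-level values at `K`.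
        (∈-resp-↭ (same (suc K)) (∈-map⁺ₛ (≡.setoid (Fin m)) S (λ { refl → Setoid.refl S }) (∈-allFin v)))
  in u , λ k k<K → begin
    walks G k v                                 ≡⟨ multisetWalks-iteratedDegree G K k (ℕ.<⇒≤ k<K) v ⟨
    multisetWalks K k (iteratedDegree G K v)    ≡⟨ multisetWalks-cong K k d[v]≈d[u] ⟩
    multisetWalks K k (iteratedDegree H K u)    ≡⟨ multisetWalks-iteratedDegree H K k (ℕ.<⇒≤ k<K) u ⟩
    walks H k u                                 ∎
  where
  S = iteratedMultisetSetoid K
  open PermutationProperties S using (∈-resp-↭)
  open SetoidMembershipProperties using () renaming (∈-map⁺ to ∈-map⁺ₛ; ∈-map⁻ to ∈-map⁻ₛ)
  open ≡.≡-Reasoning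

-- Invariance of iterated degrees under isomorphism.

module _ {m n} {G : Graph m} {H : Graph n} (G≅H : G ≅ H) where
  open _≅_ G≅H
  open Inverse bijection using (to; from; strictlyInverseˡ)
  open Injection (↔⇒↣ bijection) using (injective)

  to-from-∈ : ∀ {u xs} → from u ∈ xs → u ∈ map to xs
  to-from-∈ {u} {xs} = ≡.subst (_∈ map to xs) (strictlyInverseˡ u) ∘ ∈-map⁺ to

  -- Lists without repetition that have the same members are permutations of each other;
  -- `neighbours-↭` rests on the same fact.
  allFin-↭ : map to (allFin m) ↭ allFin n
  allFin-↭ = ∼bag⇒↭ (unique∧set⇒bag (Unique.map⁺ injective (Unique.allFin⁺ m)) (Unique.allFin⁺ n)
    (mk⇔ (λ _ → ∈-allFin _) (λ _ → to-from-∈ (∈-allFin _))))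

  neighbours-↭ : ∀ v → map to (neighbours G v) ↭ neighbours H (to v)
  neighbours-↭ v = ∼bag⇒↭ (unique∧set⇒bag
    (Unique.map⁺ injective (Unique.filter⁺ _ (Unique.allFin⁺ m))) (Unique.filter⁺ _ (Unique.allFin⁺ n))
    (mk⇔ image⊆ image⊇))
    where
    image⊆ : ∀ {u} → u ∈ map to (neighbours G v) → u ∈ neighbours H (to v)
    image⊆ u∈ with ∈-map⁻ to u∈
    ... | w , w∈ , refl = ∈-filter⁺ (T? ∘ adj H (to v)) (∈-allFin (to w))
            (≡.subst T (preserves v w) (proj₂ (∈-filter⁻ (T? ∘ adj G v) {xs = allFin m} w∈)))

    image⊇ : ∀ {u} → u ∈ neighbours H (to v) → u ∈ map to (neighbours G v)
    image⊇ {u} u∈ = to-from-∈ (∈-filter⁺ (T? ∘ adj G v) (∈-allFin (from u))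
      (≡.subst T (≡.sym (≡.trans (preserves v (from u)) (cong (adj H (to v)) (strictlyInverseˡ u))))
        (proj₂ (∈-filter⁻ (T? ∘ adj H (to v)) {xs = allFin n} u∈))))

  -- First each entry is replaced by that of its image under `to`, then the list is permuted. It
  -- serves neighbour lists and the list of all vertices alike.
  map-iteratedDegree-↭ : ∀ r →
    (∀ v → Setoid._≈_ (iteratedMultisetSetoid r) (iteratedDegree G r v) (iteratedDegree H r (to v))) →
    ∀ {vs us} → map to vs ↭ us →
    Permutation._↭_ (iteratedMultisetSetoid r) (map (iteratedDegree G r) vs) (map (iteratedDegree H r) us)
  map-iteratedDegree-↭ r d≈d {vs} vs↭us = Permutation.trans
    (Permutation.refl (Pointwise.map⁺ _ _ (Pointwise.refl (λ {v} → d≈d v))))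
    (≡.subst (λ M → Permutation._↭_ S M _) (≡.sym (map-∘ vs))
      (PermutationProperties.map⁺ (≡.setoid (Fin n)) S (λ { refl → Setoid.refl S }) (↭⇒↭ₛ vs↭us)))
    where S = iteratedMultisetSetoid r

  iteratedDegree-≈ : ∀ r v →
    Setoid._≈_ (iteratedMultisetSetoid r) (iteratedDegree G r v) (iteratedDegree H r (to v))
  iteratedDegree-≈ zero    v = ≡.trans (≡.sym (length-map to (neighbours G v))) (↭-length (neighbours-↭ v))
  iteratedDegree-≈ (suc r) v = map-iteratedDegree-↭ r (iteratedDegree-≈ r) (neighbours-↭ v)

  ≅⇒sameIteratedDegrees : SameIteratedDegreeSequence G H
  -- The sequence begins with the multiset of degrees twice, so level 0 is used here and again for
  -- `suc 0`.
  ≅⇒sameIteratedDegrees zero    = map-iteratedDegree-↭ 0 (iteratedDegree-≈ 0) allFin-↭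
  ≅⇒sameIteratedDegrees (suc r) = map-iteratedDegree-↭ r (iteratedDegree-≈ r) allFin-↭

-- Invariance of C² truth under isomorphism.

module _ {m n} {G : Graph m} {H : Graph n} (G≅H : G ≅ H) where
  open _≅_ G≅H
  open Inverse bijection using (to; from; strictlyInverseˡ)
  open Injection (↔⇒↣ bijection) using (injective)

  -- `u` is kept apart from `to v` because, going back from `H`, the given vertex is `u` and `v` is
  -- `from u`.
  extend-≅ : ∀ x φ {ρ : ∀ z → z ≢ x × Free z φ → Fin m} {σ : ∀ z → z ≢ x × Free z φ → Fin n} →
             (∀ z z∈φ → σ z z∈φ ≡ to (ρ z z∈φ)) → ∀ {v u} → u ≡ to v →
             ∀ z z∈φ → extend x φ σ u z z∈φ ≡ to (extend x φ ρ v z z∈φ)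
  extend-≅ x φ σ≡to∘ρ u≡to[v] z z∈φ with z Fin.≟ x
  ... | yes _   = u≡to[v]
  ... | no  z≢x = σ≡to∘ρ z (z≢x , z∈φ)

  satisfies-≅ : ∀ φ (ρ : Assignment m φ) (σ : Assignment n φ) →
                (∀ z z∈φ → σ z z∈φ ≡ to (ρ z z∈φ)) → Satisfies G φ ρ ⇔ Satisfies H φ σ
  satisfies-≅ (x ≐ y) ρ σ σ≡to∘ρ = mk⇔
    (λ ρx≡ρy → ≡.trans (σ≡to∘ρ x _) (≡.trans (cong to ρx≡ρy) (≡.sym (σ≡to∘ρ y _))))
    (λ σx≡σy → injective (≡.trans (≡.sym (σ≡to∘ρ x _)) (≡.trans σx≡σy (σ≡to∘ρ y _))))
  satisfies-≅ (E x y) ρ σ σ≡to∘ρ = mk⇔ (≡.trans (≡.sym adj≡adj)) (≡.trans adj≡adj)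
    where
    adj≡adj = ≡.trans (preserves (ρ x (inj₁ refl)) (ρ y (inj₂ refl)))
      (≡.sym (cong₂ (adj H) (σ≡to∘ρ x (inj₁ refl)) (σ≡to∘ρ y (inj₂ refl))))
  satisfies-≅ (¬′ φ) ρ σ σ≡to∘ρ = mk⇔ (_∘ Equivalence.from ih) (_∘ Equivalence.to ih)
    where ih = satisfies-≅ φ ρ σ σ≡to∘ρ
  satisfies-≅ (φ ∨′ ψ) ρ σ σ≡to∘ρ = mk⇔
    (Sum.map (Equivalence.to ihφ) (Equivalence.to ihψ))
    (Sum.map (Equivalence.from ihφ) (Equivalence.from ihψ))
    where
    ihφ = satisfies-≅ φ _ _ λ z → σ≡to∘ρ z ∘ inj₁
    ihψ = satisfies-≅ ψ _ _ λ z → σ≡to∘ρ z ∘ inj₂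
  satisfies-≅ (∃′ x φ) ρ σ σ≡to∘ρ = mk⇔
    (λ (v , φ[v]) → to v , Equivalence.to (ih refl) φ[v])
    (λ (u , φ[u]) → from u , Equivalence.from (ih (≡.sym (strictlyInverseˡ u))) φ[u])
    where
    ih : ∀ {v u} → u ≡ to v → Satisfies G φ (extend x φ ρ v) ⇔ Satisfies H φ (extend x φ σ u)
    ih = satisfies-≅ φ _ _ ∘ extend-≅ x φ σ≡to∘ρ
  satisfies-≅ (∃≥ d x φ) ρ σ σ≡to∘ρ = mk⇔
    (λ (f , φ[f]) → (↔⇒↣ bijection ∘↣ f) , λ i → Equivalence.to (ih refl) (φ[f] i))
    (λ (f , φ[f]) → (↔⇒↣ (↔-sym bijection) ∘↣ f) ,
      λ i → Equivalence.from (ih (≡.sym (strictlyInverseˡ (Injection.to f i)))) (φ[f] i))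
    where
    _∘↣_ : ∀ {k l} → Fin k ↣ Fin l → Fin d ↣ Fin k → Fin d ↣ Fin l
    g ∘↣ f = mk↣ {to = Injection.to g ∘ Injection.to f} (Injection.injective f ∘ Injection.injective g)
    ih : ∀ {v u} → u ≡ to v → Satisfies G φ (extend x φ ρ v) ⇔ Satisfies H φ (extend x φ σ u)
    ih = satisfies-≅ φ _ _ ∘ extend-≅ x φ σ≡to∘ρ

  ≅⇒C²-equivalent : C²-Equivalent G H
  ≅⇒C²-equivalent φ closed = satisfies-≅ φ _ _ λ z z∈φ → ⊥-elim (closed z z∈φ)

-- Counting by injections into a list.

module _ {a} {A : Set a} where

  lookup-injective : ∀ {xs : List A} → Unique xs → ∀ i j → lookup xs i ≡ lookup xs j → i ≡ j
  lookup-injective (_    ∷ _)   zero    zero    _ = refl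
  lookup-injective (x∉xs ∷ _)   zero    (suc j) x≡xs[j] =
    contradiction x≡xs[j] (All.lookup x∉xs (∈-lookup j))
  lookup-injective (x∉xs ∷ _)   (suc i) zero    xs[i]≡x =
    contradiction (≡.sym xs[i]≡x) (All.lookup x∉xs (∈-lookup i))
  lookup-injective (_    ∷ xs!) (suc i) (suc j) eq = cong suc (lookup-injective xs! i j eq)

  -- Taking positions turns an injection into members of `xs` into one into `Fin (length xs)`;
  -- conversely the first `d` positions have distinct entries. This turns the semantics of `∃≥` into
  -- a comparison of numbers.
  injection-into⇔≤length : ∀ {xs : List A} → Unique xs → ∀ d →
    (Σ (Fin d ↣ A) λ f → ∀ i → Injection.to f i ∈ xs) ⇔ d ℕ.≤ length xs
  injection-into⇔≤length {xs} xs! d = mk⇔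
    (λ (f , f∈xs) → Fin.injective⇒≤ λ {i} {j} same-index → Injection.injective f (begin
      Injection.to f i              ≡⟨ lookup-index (f∈xs i) ⟩
      lookup xs (index (f∈xs i))    ≡⟨ cong (lookup xs) same-index ⟩
      lookup xs (index (f∈xs j))    ≡⟨ lookup-index (f∈xs j) ⟨
      Injection.to f j              ∎))
    (λ d≤ → mk↣ {to = λ i → lookup xs (inject≤ i d≤)}
              (λ {i} {j} → Fin.inject≤-injective d≤ d≤ i j ∘ lookup-injective xs! _ _) ,
            λ i → ∈-lookup (inject≤ i d≤))
    where open ≡.≡-Reasoning

-- Definability in C²

VertexPredicate : Set₁
VertexPredicate = ∀ {n} → Graph n → Fin n → Set

VertexFunction : Set
VertexFunction = ∀ {n} → Graph n → Fin n → ℕ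

-- One formula must serve every graph. Assignments are functions known only pointwise, so
-- `satisfies` covers each one that takes the value `v` on the free variables.
record DefinableIn (x : Var) (P : VertexPredicate) : Set where
  field
    formula   : Formula
    free      : ∀ z → Free z formula → z ≡ x
    satisfies : ∀ {n} (G : Graph n) (ρ : Assignment n formula) v →
                (∀ z z∈φ → ρ z z∈φ ≡ v) → Satisfies G formula ρ ⇔ P G v

open DefinableIn

-- Either variable can be the free one, because passing to a neighbour swaps the two.
Definable : VertexPredicate → Set
Definable P = ∀ x → DefinableIn x P

definable-⇔ : ∀ {P Q : VertexPredicate} → (∀ {n} (G : Graph n) v → P G v ⇔ Q G v) →
              Definable P → Definable Q
definable-⇔ P⇔Q defP x = record
  { formula   = formula (defP x)
  ; free      = free (defP x)
  ; satisfies = λ G ρ v ρ≡v → mk⇔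
      (Equivalence.to (P⇔Q G v) ∘ Equivalence.to (satisfies (defP x) G ρ v ρ≡v))
      (Equivalence.from (satisfies (defP x) G ρ v ρ≡v) ∘ Equivalence.from (P⇔Q G v)) }

definable-⊤ : Definable (λ _ _ → ⊤)
definable-⊤ x = record
  { formula   = x ≐ x
  ; free      = λ z → [ id , id ]′
  ; satisfies = λ G ρ v ρ≡v → mk⇔ _ λ _ → ≡.trans (ρ≡v x (inj₁ refl)) (≡.sym (ρ≡v x (inj₂ refl))) }

definable-¬ : ∀ {P : VertexPredicate} → Definable P → Definable (λ G v → ¬ P G v)
definable-¬ defP x = record
  { formula   = ¬′ formula (defP x)
  ; free      = free (defP x)
  ; satisfies = λ G ρ v ρ≡v → let ⇔P = satisfies (defP x) G ρ v ρ≡v in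
      mk⇔ (_∘ Equivalence.from ⇔P) (_∘ Equivalence.to ⇔P) }

definable-⊎ : ∀ {P Q : VertexPredicate} → Definable P → Definable Q →
              Definable (λ G v → P G v ⊎ Q G v)
definable-⊎ defP defQ x = record
  { formula   = formula (defP x) ∨′ formula (defQ x)
  ; free      = λ z → [ free (defP x) z , free (defQ x) z ]′
  ; satisfies = λ G ρ v ρ≡v →
      let ⇔P = satisfies (defP x) G _ v (λ z → ρ≡v z ∘ inj₁)
          ⇔Q = satisfies (defQ x) G _ v (λ z → ρ≡v z ∘ inj₂)
      in mk⇔ (Sum.map (Equivalence.to ⇔P) (Equivalence.to ⇔Q))
             (Sum.map (Equivalence.from ⇔P) (Equivalence.from ⇔Q)) }

-- Conjunction is not a constructor of `Formula`; its De Morgan form is recovered constructively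
-- from decidability of the components.
¬[¬⊎¬]⇔× : ∀ {A B : Set} → Dec A → Dec B → (¬ (¬ A ⊎ ¬ B)) ⇔ (A × B)
¬[¬⊎¬]⇔× A? B? = mk⇔
  (λ ¬¬ → decidable-stable A? (¬¬ ∘ inj₁) , decidable-stable B? (¬¬ ∘ inj₂))
  (λ (a , b) → [ contradiction a , contradiction b ]′)

definable-× : ∀ {P Q : VertexPredicate} → (∀ {n} (G : Graph n) v → Dec (P G v)) →
              (∀ {n} (G : Graph n) v → Dec (Q G v)) → Definable P → Definable Q →
              Definable (λ G v → P G v × Q G v)
definable-× P? Q? defP defQ = definable-⇔ (λ G v → ¬[¬⊎¬]⇔× (P? G v) (Q? G v))
  (definable-¬ (definable-⊎ (definable-¬ defP) (definable-¬ defQ)))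

definable-const : ∀ {A : Set} → Dec A → Definable (λ _ _ → A)
definable-const (yes a) = definable-⇔ (λ _ _ → mk⇔ (λ _ → a) _) definable-⊤
definable-const (no ¬a) = definable-⇔ (λ _ _ → mk⇔ (λ ¬⊤ → contradiction tt ¬⊤) (λ a → contradiction a ¬a))
                                      (definable-¬ definable-⊤)

extend-new : ∀ {n} x φ (ρ : ∀ z → z ≢ x × Free z φ → Fin n) v {z} (z∈φ : Free z φ) → z ≡ x →
             extend x φ ρ v z z∈φ ≡ v
extend-new x φ ρ v {z} z∈φ z≡x with z Fin.≟ x
... | yes _   = refl
... | no  z≢x = contradiction z≡x z≢x

extend-old : ∀ {n} x φ (ρ : ∀ z → z ≢ x × Free z φ → Fin n) v {w} → (∀ z z∈φ → ρ z z∈φ ≡ w) →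
             ∀ {z} (z∈φ : Free z φ) → z ≢ x → extend x φ ρ v z z∈φ ≡ w
extend-old x φ ρ v ρ≡w {z} z∈φ z≢x with z Fin.≟ x
... | yes z≡x = contradiction z≡x z≢x
... | no  z≢x = ρ≡w z (z≢x , z∈φ)

countNeighbours : ∀ {P : VertexPredicate} → (∀ {n} (G : Graph n) v → Dec (P G v)) → VertexFunction
countNeighbours P? G v = length (filter (P? G) (neighbours G v))

other : Var → Var
other 0F = 1F
other 1F = 0F

other-≢ : ∀ x → x ≢ other x
other-≢ 0F ()
other-≢ 1F ()

-- The formula says that at least `d` values of `y` satisfy `E x y` and `ψ`. Since `ψ` has only `y`
-- free, it may quantify `x` again, and two variables suffice at every depth.
definable-countNeighbours : ∀ {P : VertexPredicate} (P? : ∀ {n} (G : Graph n) v → Dec (P G v)) →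
  Definable P → ∀ d → Definable (λ G v → d ℕ.≤ countNeighbours P? G v)
definable-countNeighbours {P} P? defP d x = record
  { formula   = ∃≥ d y body
  ; free      = λ z (z≢y , z∈) → [ [ id , (λ z≡y → contradiction z≡y z≢y) ]′
                                 , (λ z∈ψ → contradiction (free (defP y) z z∈ψ) z≢y) ]′ z∈
  ; satisfies = λ {n} G ρ v ρ≡v →
      let xs! : Unique (filter (P? G) (neighbours G v))
          xs! = Unique.filter⁺ (P? G) (Unique.filter⁺ (T? ∘ adj G v) (Unique.allFin⁺ n))
          ⇔≤ = injection-into⇔≤length xs! d
      in mk⇔ (λ (f , φ[f]) → Equivalence.to ⇔≤ (f , λ i → Equivalence.to (body-satisfies G ρ v ρ≡v _) (φ[f] i)))
             (λ d≤ → let f , f∈ = Equivalence.from ⇔≤ d≤ in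
                     f , λ i → Equivalence.from (body-satisfies G ρ v ρ≡v _) (f∈ i)) }
  where
  y = other x
  ψ = formula (defP y)
  body = ¬′ ((¬′ E x y) ∨′ (¬′ ψ))

  body-satisfies : ∀ {n} (G : Graph n) (ρ : Assignment n (∃≥ d y body)) v →
    (∀ z z∈φ → ρ z z∈φ ≡ v) → ∀ u →
    Satisfies G body (extend y body ρ u) ⇔ u ∈ filter (P? G) (neighbours G v)
  body-satisfies {n} G ρ v ρ≡v u = mk⇔
    (λ sat →
      let vu∈E , P[u] = Equivalence.to ⇔× λ
            { (inj₁ ¬vu∈E) → sat (inj₁ λ e → ¬vu∈E (Equivalence.from T-≡ (≡.trans (≡.sym E≡) e)))
            ; (inj₂ ¬P[u]) → sat (inj₂ λ s → ¬P[u] (Equivalence.to ⇔P s)) }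
      in ∈-filter⁺ (P? G) (∈-filter⁺ (T? ∘ adj G v) (∈-allFin u) vu∈E) P[u])
    (λ u∈ →
      let u∈N , P[u] = ∈-filter⁻ (P? G) {xs = neighbours G v} u∈
          _ , vu∈E = ∈-filter⁻ (T? ∘ adj G v) {xs = allFin n} u∈N
      in λ { (inj₁ ¬E) → ¬E (≡.trans E≡ (Equivalence.to T-≡ vu∈E))
           ; (inj₂ ¬ψ) → ¬ψ (Equivalence.from ⇔P P[u]) })
    where
    ⇔× = ¬[¬⊎¬]⇔× (T? (adj G v u)) (P? G u)
    ρ[x]≡v : ∀ x∈ → extend y body ρ u x x∈ ≡ v
    ρ[x]≡v x∈ = extend-old y body ρ u ρ≡v x∈ (other-≢ x)
    ρ[y]≡u : ∀ {z} z∈ → z ≡ y → extend y body ρ u z z∈ ≡ u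
    ρ[y]≡u z∈ = extend-new y body ρ u z∈
    E≡ = cong₂ (adj G) (ρ[x]≡v (inj₁ (inj₁ refl))) (ρ[y]≡u (inj₁ (inj₂ refl)) refl)
    ⇔P = satisfies (defP y) G _ u (λ z z∈ψ → ρ[y]≡u (inj₂ z∈ψ) (free (defP y) z z∈ψ))

-- Thresholds rather than values, because lower bounds are what `∃≥` expresses.
Measurable : VertexFunction → Set
Measurable f = ∀ c → Definable (λ G v → c ℕ.≤ f G v)

measurable-≗ : ∀ {f g : VertexFunction} → (∀ {n} (G : Graph n) v → f G v ≡ g G v) →
               Measurable f → Measurable g
measurable-≗ f≗g meas-f c = definable-⇔
  (λ G v → mk⇔ (≡.subst (c ℕ.≤_) (f≗g G v)) (≡.subst (c ℕ.≤_) (≡.sym (f≗g G v)))) (meas-f c)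

measurable-const : ∀ a → Measurable (λ _ _ → a)
measurable-const a c = definable-const (c ℕ.≤? a)

module _ {f g : VertexFunction} (meas-f : Measurable f) (meas-g : Measurable g) where

  -- Subtracting a from g makes an induction on the threshold possible.
  definable-≤-+-∸ : ∀ c a → Definable (λ G v → c ℕ.≤ f G v ℕ.+ (g G v ℕ.∸ a))
  definable-≤-+-∸ zero    a = definable-⇔ (λ _ _ → mk⇔ (λ _ → ℕ.z≤n) _) definable-⊤
  definable-≤-+-∸ (suc c) a = definable-⇔ (λ G v → mk⇔ (combine (f G v) (g G v)) (split (f G v) (g G v)))
    (definable-⊎ (meas-f (suc c))
      (definable-× (λ G v → suc a ℕ.≤? g G v) (λ G v → c ℕ.≤? f G v ℕ.+ (g G v ℕ.∸ suc a))
        (meas-g (suc a)) (definable-≤-+-∸ c (suc a))))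
    where
    step : ∀ s t → a ℕ.< t → s ℕ.+ (t ℕ.∸ a) ≡ suc (s ℕ.+ (t ℕ.∸ suc a))
    step s t a<t = ≡.trans (cong (s ℕ.+_) (ℕ.+-∸-assoc 1 a<t)) (ℕ.+-suc s (t ℕ.∸ suc a))

    combine : ∀ s t → suc c ℕ.≤ s ⊎ (a ℕ.< t × c ℕ.≤ s ℕ.+ (t ℕ.∸ suc a)) → suc c ℕ.≤ s ℕ.+ (t ℕ.∸ a)
    combine s t (inj₁ c<s)        = ℕ.≤-trans c<s (ℕ.m≤m+n s (t ℕ.∸ a))
    combine s t (inj₂ (a<t , c≤)) = ≡.subst (suc c ℕ.≤_) (≡.sym (step s t a<t)) (ℕ.s≤s c≤)

    split : ∀ s t → suc c ℕ.≤ s ℕ.+ (t ℕ.∸ a) → suc c ℕ.≤ s ⊎ (a ℕ.< t × c ℕ.≤ s ℕ.+ (t ℕ.∸ suc a))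
    split s t c< with a ℕ.<? t
    ... | yes a<t = inj₂ (a<t , ℕ.s≤s⁻¹ (≡.subst (suc c ℕ.≤_) (step s t a<t) c<))
    ... | no  a≮t = inj₁ (≡.subst (suc c ℕ.≤_)
      (≡.trans (cong (s ℕ.+_) (ℕ.m≤n⇒m∸n≡0 (ℕ.≮⇒≥ a≮t))) (ℕ.+-identityʳ s)) c<)

  measurable-+ : Measurable (λ G v → f G v ℕ.+ g G v)
  measurable-+ c = definable-≤-+-∸ c 0

-- Sums with capped terms.

module _ {a} {A : Set a} (f : A → ℕ) where

  sum-⊓-zero : ∀ xs → sumᴸ (map (λ x → f x ℕ.⊓ 0) xs) ≡ 0
  sum-⊓-zero []       = refl
  sum-⊓-zero (x ∷ xs) = cong₂ ℕ._+_ (ℕ.⊓-zeroʳ (f x)) (sum-⊓-zero xs)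

  -- Raising the cap from `t` to `suc t` adds one for each entry whose value exceeds `t`.
  sum-⊓-suc : ∀ t xs → sumᴸ (map (λ x → f x ℕ.⊓ suc t) xs) ≡
                       sumᴸ (map (λ x → f x ℕ.⊓ t) xs) ℕ.+ length (filter (λ x → suc t ℕ.≤? f x) xs)
  sum-⊓-suc t []       = refl
  sum-⊓-suc t (x ∷ xs) with suc t ℕ.≤? f x
  ... | yes t<fx = begin
    f x ℕ.⊓ suc t ℕ.+ sumᴸ (map (λ x → f x ℕ.⊓ suc t) xs)
      ≡⟨ cong₂ ℕ._+_ (ℕ.m≥n⇒m⊓n≡n t<fx) (sum-⊓-suc t xs) ⟩
    suc t ℕ.+ (S ℕ.+ L)
      ≡⟨ cong suc (ℕ.+-assoc t S L) ⟨
    suc (t ℕ.+ S ℕ.+ L)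
      ≡⟨ ℕ.+-suc (t ℕ.+ S) L ⟨
    t ℕ.+ S ℕ.+ suc L
      ≡⟨ cong₂ (λ r l → r ℕ.+ S ℕ.+ l) (ℕ.m≥n⇒m⊓n≡n (ℕ.<⇒≤ t<fx)) (cong length (filter-accept P? t<fx)) ⟨
    f x ℕ.⊓ t ℕ.+ S ℕ.+ length (filter P? (x ∷ xs)) ∎
    where
    open ≡.≡-Reasoning
    P? = λ x → suc t ℕ.≤? f x
    S = sumᴸ (map (λ x → f x ℕ.⊓ t) xs)
    L = length (filter P? xs)
  ... | no  t≮fx = begin
    f x ℕ.⊓ suc t ℕ.+ sumᴸ (map (λ x → f x ℕ.⊓ suc t) xs)
      ≡⟨ cong₂ ℕ._+_ (≡.trans (ℕ.m≤n⇒m⊓n≡m (ℕ.m≤n⇒m≤1+n fx≤t)) (≡.sym (ℕ.m≤n⇒m⊓n≡m fx≤t)))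
                     (sum-⊓-suc t xs) ⟩
    f x ℕ.⊓ t ℕ.+ (S ℕ.+ L)
      ≡⟨ ℕ.+-assoc (f x ℕ.⊓ t) S L ⟨
    f x ℕ.⊓ t ℕ.+ S ℕ.+ L
      ≡⟨ cong (λ l → f x ℕ.⊓ t ℕ.+ S ℕ.+ l) (cong length (filter-reject P? t≮fx)) ⟨
    f x ℕ.⊓ t ℕ.+ S ℕ.+ length (filter P? (x ∷ xs)) ∎
    where
    open ≡.≡-Reasoning
    fx≤t = ℕ.s≤s⁻¹ (ℕ.≰⇒> t≮fx)
    P? = λ x → suc t ℕ.≤? f x
    S = sumᴸ (map (λ x → f x ℕ.⊓ t) xs)
    L = length (filter P? xs)

  -- An entry that reaches `c` brings the capped sum to `c` on its own; if there is none, the cap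
  -- changes nothing.
  truncated-sum : ∀ c xs → c ℕ.≤ sumᴸ (map (λ x → f x ℕ.⊓ c) xs) ⊎
                           sumᴸ (map (λ x → f x ℕ.⊓ c) xs) ≡ sumᴸ (map f xs)
  truncated-sum c []       = inj₂ refl
  truncated-sum c (x ∷ xs) with c ℕ.≤? f x | truncated-sum c xs
  ... | yes c≤fx | _        = inj₁ (ℕ.≤-trans (ℕ.≤-reflexive (≡.sym (ℕ.m≥n⇒m⊓n≡n c≤fx))) (ℕ.m≤m+n _ _))
  ... | no  _    | inj₁ c≤S = inj₁ (ℕ.≤-trans c≤S (ℕ.m≤n+m _ _))
  ... | no  c≰fx | inj₂ S≡  = inj₂ (cong₂ ℕ._+_ (ℕ.m≤n⇒m⊓n≡m (ℕ.≰⇒≥ c≰fx)) S≡)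

  sum-⊓≤sum : ∀ c xs → sumᴸ (map (λ x → f x ℕ.⊓ c) xs) ℕ.≤ sumᴸ (map f xs)
  sum-⊓≤sum c []       = ℕ.z≤n
  sum-⊓≤sum c (x ∷ xs) = ℕ.+-mono-≤ (ℕ.m⊓n≤m (f x) c) (sum-⊓≤sum c xs)

  ≤truncated-sum⇔≤sum : ∀ c xs → c ℕ.≤ sumᴸ (map (λ x → f x ℕ.⊓ c) xs) ⇔ c ℕ.≤ sumᴸ (map f xs)
  ≤truncated-sum⇔≤sum c xs = mk⇔ (λ c≤ → ℕ.≤-trans c≤ (sum-⊓≤sum c xs))
    (λ c≤ → [ id , (λ S≡ → ≡.subst (c ℕ.≤_) (≡.sym S≡) c≤) ]′ (truncated-sum c xs))

module _ {f : VertexFunction} (meas-f : Measurable f) where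

  -- Σ min(f, t) = Σ_{s ≤ t} #{f ≥ s}, and truncating at c does not change whether a sum reaches c.
  measurable-truncatedNeighbourSum : ∀ t → Measurable (λ G v → sumᴸ (map (λ u → f G u ℕ.⊓ t) (neighbours G v)))
  measurable-truncatedNeighbourSum zero    =
    measurable-≗ (λ G v → ≡.sym (sum-⊓-zero (f G) (neighbours G v))) (measurable-const 0)
  measurable-truncatedNeighbourSum (suc t) =
    measurable-≗ (λ G v → ≡.sym (sum-⊓-suc (f G) t (neighbours G v)))
      (measurable-+ (measurable-truncatedNeighbourSum t)
        (definable-countNeighbours (λ G v → suc t ℕ.≤? f G v) (meas-f (suc t))))

  measurable-neighbourSum : Measurable (λ G v → sumᴸ (map (f G) (neighbours G v)))
  measurable-neighbourSum c = definable-⇔ (λ G v → ≤truncated-sum⇔≤sum (f G) c (neighbours G v))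
    (measurable-truncatedNeighbourSum c c)

measurable-walks : ∀ k → Measurable (λ G → walks G k)
measurable-walks zero    = measurable-const 1
measurable-walks (suc k) = measurable-neighbourSum (measurable-walks k)

definable-≡ : ∀ {f : VertexFunction} → Measurable f → ∀ c → Definable (λ G v → f G v ≡ c)
definable-≡ {f} meas-f c = definable-⇔
  (λ G v → mk⇔ (λ (c≤ , c≮) → ℕ.≤-antisym (ℕ.≮⇒≥ c≮) c≤)
               (λ f≡c → ℕ.≤-reflexive (≡.sym f≡c) , λ c< → ℕ.<-irrefl (≡.sym f≡c) c<))
  (definable-× (λ G v → c ℕ.≤? f G v) (λ G v → ¬? (suc c ℕ.≤? f G v))
    (meas-f c) (definable-¬ (meas-f (suc c))))

definable-walks-≡ : ∀ (c : ℕ → ℕ) K → Definable (λ G v → ∀ k → k ℕ.< K → walks G k v ≡ c k)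
definable-walks-≡ c zero    = definable-⇔ (λ G v → mk⇔ (λ _ _ ()) _) definable-⊤
definable-walks-≡ c (suc K) = definable-⇔
  (λ G v → mk⇔ (λ (below , top) k k<1+K → [ below k , (λ { refl → top }) ]′ (ℕ.m<1+n⇒m<n∨m≡n k<1+K))
               (λ all → (λ k k<K → all k (ℕ.m<n⇒m<1+n k<K)) , all K (ℕ.n<1+n K)))
  (definable-×
    (λ G v → map′ (λ below k → below {k}) (λ below {k} → below k)
      (ℕ.allUpTo? (λ k → walks G k v ℕ.≟ c k) K))
    (λ G v → walks G K v ℕ.≟ c K) (definable-walks-≡ c K) (definable-≡ (measurable-walks K) (c K)))

-- If φ defines `P`, then `∃′ 0F φ` is a sentence, so its truth carries over from `G` to `H`.
C²-transfer : ∀ {m n} {G : Graph m} {H : Graph n} {P : VertexPredicate} →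
              C²-Equivalent G H → Definable P → ∃ (P G) → ∃ (P H)
C²-transfer {G = G} {H} {P} G≡H defP (v , P[v]) =
  let u , φ[u] = Equivalence.to (G≡H (∃′ 0F φ) closed) (v , Equivalence.from (φ⇔P G v) P[v])
  in u , Equivalence.to (φ⇔P H u) φ[u]
  where
  φ = formula (defP 0F)
  closed : Sentence (∃′ 0F φ)
  closed z (z≢x , z∈φ) = z≢x (free (defP 0F) z z∈φ)
  φ⇔P : ∀ {n} (G : Graph n) {ρ : Assignment n (∃′ 0F φ)} v → Satisfies G φ (extend 0F φ ρ v) ⇔ P G v
  φ⇔P G {ρ} v = satisfies (defP 0F) G _ v λ z z∈φ → extend-new 0F φ ρ v z∈φ (free (defP 0F) z z∈φ)

C²-equivalent⇒dominated : ∀ {m n} (G : Graph m) (H : Graph n) → C²-Equivalent G H → WalksDominated G H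
C²-equivalent⇒dominated G H G≡H K v =
  -- The counts of `v` enter as fixed numbers, which makes the predicate meaningful in `H` as well.
  let u , same = C²-transfer G≡H (definable-walks-≡ (λ k → walks G k v) K) (v , λ _ _ → refl)
  in u , λ k k<K → ≡.sym (same k k<K)

-- The real numbers as an ordered semiring

module RealNumbers where

  open Defs using (_≈_; _≤_; _+_; _*_)

  module _ where
    open +-*-Solver

    telescope : ∀ a b c → a ℚ.- c ≡ (a ℚ.- b) ℚ.+ (b ℚ.- c)
    telescope = solve 3 (λ a b c → a :- c := (a :- b) :+ (b :- c)) refl

    interchange : ∀ a b c d → (a ℚ.+ b) ℚ.+ (c ℚ.+ d) ≡ (a ℚ.+ c) ℚ.+ (b ℚ.+ d)
    interchange = solve 4 (λ a b c d → (a :+ b) :+ (c :+ d) := (a :+ c) :+ (b :+ d)) refl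

    difference-+ : ∀ a b c d → (a ℚ.+ b) ℚ.- (c ℚ.+ d) ≡ (a ℚ.- c) ℚ.+ (b ℚ.- d)
    difference-+ = solve 4 (λ a b c d → (a :+ b) :- (c :+ d) := (a :- c) :+ (b :- d)) refl

    difference-* : ∀ a b c → a ℚ.* c ℚ.- b ℚ.* c ≡ (a ℚ.- b) ℚ.* c
    difference-* = solve 3 (λ a b c → a :* c :- b :* c := (a :- b) :* c) refl

    subtract-add : ∀ a b → a ≡ (a ℚ.- b) ℚ.+ b
    subtract-add = solve 2 (λ a b → a := (a :- b) :+ b) refl

  ∣p-q∣≡∣q-p∣ : ∀ p q → ∣ p ℚ.- q ∣ ≡ ∣ q ℚ.- p ∣
  ∣p-q∣≡∣q-p∣ p q = ≡.trans (≡.sym (ℚ.∣-p∣≡∣p∣ (p ℚ.- q))) (cong ∣_∣ (lemma p q))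
    where
    open +-*-Solver
    lemma : ∀ p q → ℚ.- (p ℚ.- q) ≡ q ℚ.- p
    lemma = solve 2 (λ p q → :- (p :- q) := q :- p) refl

  ½ε>0 : ∀ {ε} → 0ℚ ℚ.< ε → 0ℚ ℚ.< ε ℚ.* ½
  ½ε>0 {ε} 0<ε = ℚ.positive⁻¹ _ {{ℚ.pos*pos⇒pos ε {{positive 0<ε}} ½}}

  ½ε+½ε : ∀ ε → ε ℚ.* ½ ℚ.+ ε ℚ.* ½ ≡ ε
  ½ε+½ε ε = ≡.trans (≡.sym (ℚ.*-distribˡ-+ ε ½ ½)) (ℚ.*-identityʳ ε)

  -- The operations act termwise, so the semiring laws for `ℝ` reduce to those for `ℚ` through this.
  ≗⇒≈ : ∀ x y → (∀ n → seq x n ≡ seq y n) → x ≈ y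
  ≗⇒≈ x y x≗y ε 0<ε = 0 , λ n _ → begin
    ∣ seq x n ℚ.- seq y n ∣  ≡⟨ cong (λ q → ∣ seq x n ℚ.- q ∣) (x≗y n) ⟨
    ∣ seq x n ℚ.- seq x n ∣  ≡⟨ cong ∣_∣ (ℚ.+-inverseʳ (seq x n)) ⟩
    0ℚ                       ≤⟨ ℚ.<⇒≤ 0<ε ⟩
    ε                        ∎
    where open ℚ.≤-Reasoning

  ≈-sym : ∀ {x y} → x ≈ y → y ≈ x
  ≈-sym {x} {y} x≈y ε 0<ε with x≈y ε 0<ε
  ... | N , close = N , λ n N≤n →
    ≡.subst (ℚ._≤ ε) (∣p-q∣≡∣q-p∣ (seq x n) (seq y n)) (close n N≤n)

  ≈-trans : ∀ {x y z} → x ≈ y → y ≈ z → x ≈ z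
  ≈-trans {x} {y} {z} x≈y y≈z ε 0<ε
    with x≈y _ (½ε>0 0<ε) | y≈z _ (½ε>0 0<ε)
  ... | M , close | N , close′ = M ℕ.⊔ N , λ n ≤n → begin
    ∣ seq x n ℚ.- seq z n ∣
      ≡⟨ cong ∣_∣ (telescope (seq x n) (seq y n) (seq z n)) ⟩
    ∣ (seq x n ℚ.- seq y n) ℚ.+ (seq y n ℚ.- seq z n) ∣
      ≤⟨ ℚ.∣p+q∣≤∣p∣+∣q∣ (seq x n ℚ.- seq y n) (seq y n ℚ.- seq z n) ⟩
    ∣ seq x n ℚ.- seq y n ∣ ℚ.+ ∣ seq y n ℚ.- seq z n ∣
      ≤⟨ ℚ.+-mono-≤ (close n (ℕ.m⊔n≤o⇒m≤o M N ≤n)) (close′ n (ℕ.m⊔n≤o⇒n≤o M N ≤n)) ⟩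
    ε ℚ.* ½ ℚ.+ ε ℚ.* ½
      ≡⟨ ½ε+½ε ε ⟩
    ε ∎
    where open ℚ.≤-Reasoning

  +-cong : ∀ {x y u v} → x ≈ y → u ≈ v → x + u ≈ y + v
  +-cong {x} {y} {u} {v} x≈y u≈v ε 0<ε
    with x≈y _ (½ε>0 0<ε) | u≈v _ (½ε>0 0<ε)
  ... | M , close | N , close′ = M ℕ.⊔ N , λ n ≤n → begin
    ∣ (seq x n ℚ.+ seq u n) ℚ.- (seq y n ℚ.+ seq v n) ∣
      ≡⟨ cong ∣_∣ (difference-+ (seq x n) (seq u n) (seq y n) (seq v n)) ⟩
    ∣ (seq x n ℚ.- seq y n) ℚ.+ (seq u n ℚ.- seq v n) ∣
      ≤⟨ ℚ.∣p+q∣≤∣p∣+∣q∣ (seq x n ℚ.- seq y n) (seq u n ℚ.- seq v n) ⟩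
    ∣ seq x n ℚ.- seq y n ∣ ℚ.+ ∣ seq u n ℚ.- seq v n ∣
      ≤⟨ ℚ.+-mono-≤ (close n (ℕ.m⊔n≤o⇒m≤o M N ≤n)) (close′ n (ℕ.m⊔n≤o⇒n≤o M N ≤n)) ⟩
    ε ℚ.* ½ ℚ.+ ε ℚ.* ½
      ≡⟨ ½ε+½ε ε ⟩
    ε ∎
    where open ℚ.≤-Reasoning

  eventually-bounded : ∀ x → ∃ λ B → Positive B × ∃ λ N → ∀ n → N ℕ.≤ n → ∣ seq x n ∣ ℚ.≤ B
  eventually-bounded x with cauchy x 1ℚ (ℚ.positive⁻¹ 1ℚ)
  ... | N , close =
    1ℚ ℚ.+ ∣ seq x N ∣ ,
    ℚ.pos+nonNeg⇒pos 1ℚ ∣ seq x N ∣ {{ℚ.∣-∣-nonNeg (seq x N)}} ,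
    N , λ n N≤n → begin
      ∣ seq x n ∣
        ≡⟨ cong ∣_∣ (subtract-add (seq x n) (seq x N)) ⟩
      ∣ (seq x n ℚ.- seq x N) ℚ.+ seq x N ∣
        ≤⟨ ℚ.∣p+q∣≤∣p∣+∣q∣ (seq x n ℚ.- seq x N) (seq x N) ⟩
      ∣ seq x n ℚ.- seq x N ∣ ℚ.+ ∣ seq x N ∣
        ≤⟨ ℚ.+-monoˡ-≤ ∣ seq x N ∣ (close n N N≤n ℕ.≤-refl) ⟩
      1ℚ ℚ.+ ∣ seq x N ∣ ∎
    where open ℚ.≤-Reasoning

  divide : ∀ ε B → 0ℚ ℚ.< ε → Positive B → ∃ λ δ → 0ℚ ℚ.< δ × δ ℚ.* B ≡ ε
  divide ε B 0<ε B>0 =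
    ε ℚ.* 1/ B ,
    ℚ.positive⁻¹ _ {{ℚ.pos*pos⇒pos ε (1/ B)}} ,
    ≡.trans (ℚ.*-assoc ε (1/ B) B)
      (≡.trans (cong (ε ℚ.*_) (ℚ.*-inverseˡ B)) (ℚ.*-identityʳ ε))
    where
    instance
      _ = B>0
      _ = positive 0<ε
      _ = ℚ.pos⇒nonZero B
      _ = ℚ.1/pos⇒pos B

  ∣p*q∣≤r*s : ∀ p q {r s} → ∣ p ∣ ℚ.≤ r → ∣ q ∣ ℚ.≤ s → ∣ p ℚ.* q ∣ ℚ.≤ r ℚ.* s
  ∣p*q∣≤r*s p q {r} {s} ∣p∣≤r ∣q∣≤s = begin
    ∣ p ℚ.* q ∣       ≡⟨ ℚ.∣p*q∣≡∣p∣*∣q∣ p q ⟩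
    ∣ p ∣ ℚ.* ∣ q ∣   ≤⟨ ℚ.*-monoʳ-≤-nonNeg ∣ q ∣ {{ℚ.∣-∣-nonNeg q}} ∣p∣≤r ⟩
    r ℚ.* ∣ q ∣       ≤⟨ ℚ.*-monoˡ-≤-nonNeg r {{r≥0}} ∣q∣≤s ⟩
    r ℚ.* s           ∎
    where
    open ℚ.≤-Reasoning
    r≥0 = ℚ.nonNegative (ℚ.≤-trans (ℚ.0≤∣p∣ p) ∣p∣≤r)

  -- `z` is eventually bounded by some `B`, so tolerance ε / B between `x` and `y` is enough.
  *-congʳ : ∀ {x y} z → x ≈ y → x * z ≈ y * z
  *-congʳ {x} {y} z x≈y ε 0<ε =
    let B , B>0 , M , bound = eventually-bounded z
        δ , 0<δ , δ*B≡ε = divide ε B 0<ε B>0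
        N , close = x≈y δ 0<δ
    in M ℕ.⊔ N , λ n ≤n → begin
    ∣ seq x n ℚ.* seq z n ℚ.- seq y n ℚ.* seq z n ∣
      ≡⟨ cong ∣_∣ (difference-* (seq x n) (seq y n) (seq z n)) ⟩
    ∣ (seq x n ℚ.- seq y n) ℚ.* seq z n ∣
      ≤⟨ ∣p*q∣≤r*s (seq x n ℚ.- seq y n) (seq z n)
           (close n (ℕ.m⊔n≤o⇒n≤o M N ≤n)) (bound n (ℕ.m⊔n≤o⇒m≤o M N ≤n)) ⟩
    δ ℚ.* B
      ≡⟨ δ*B≡ε ⟩
    ε ∎
    where open ℚ.≤-Reasoning

  *-comm : ∀ x y → x * y ≈ y * x
  *-comm x y = ≗⇒≈ (x * y) (y * x) λ n → ℚ.*-comm (seq x n) (seq y n)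

  *-cong : ∀ {x y u v} → x ≈ y → u ≈ v → x * u ≈ y * v
  *-cong {x} {y} {u} {v} x≈y u≈v =
    ≈-trans {x * u} {y * u} {y * v} (*-congʳ {x} {y} u x≈y)
      (≈-trans {y * u} {u * y} {y * v} (*-comm y u)
        (≈-trans {u * y} {v * y} {y * v} (*-congʳ {u} {v} y u≈v) (*-comm v y)))

  ℝ-commutativeSemiring : CommutativeSemiring 0ℓ 0ℓ
  ℝ-commutativeSemiring = record
    { Carrier = ℝ ; _≈_ = _≈_ ; _+_ = _+_ ; _*_ = _*_ ; 0# = 0ℝ ; 1# = 1ℝ
    ; isCommutativeSemiring = record
      { isSemiring = record
        { isSemiringWithoutAnnihilatingZero = record
          { +-isCommutativeMonoid = record
            { isMonoid = record
              { isSemigroup = record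
                { isMagma = record
                  { isEquivalence = record
                    { refl  = λ {x} → ≗⇒≈ x x λ _ → refl
                    ; sym   = λ {x} {y} → ≈-sym {x} {y}
                    ; trans = λ {x} {y} {z} → ≈-trans {x} {y} {z} }
                  ; ∙-cong = λ {x} {y} {u} {v} → +-cong {x} {y} {u} {v} }
                ; assoc = λ x y z → ≗⇒≈ (x + y + z) (x + (y + z))
                    λ n → ℚ.+-assoc (seq x n) (seq y n) (seq z n) }
              ; identity = (λ x → ≗⇒≈ (0ℝ + x) x λ n → ℚ.+-identityˡ (seq x n))
                         , (λ x → ≗⇒≈ (x + 0ℝ) x λ n → ℚ.+-identityʳ (seq x n)) }
            ; comm = λ x y → ≗⇒≈ (x + y) (y + x) λ n → ℚ.+-comm (seq x n) (seq y n) }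
          ; *-cong = λ {x} {y} {u} {v} → *-cong {x} {y} {u} {v}
          ; *-assoc = λ x y z → ≗⇒≈ (x * y * z) (x * (y * z))
              λ n → ℚ.*-assoc (seq x n) (seq y n) (seq z n)
          ; *-identity = (λ x → ≗⇒≈ (1ℝ * x) x λ n → ℚ.*-identityˡ (seq x n))
                       , (λ x → ≗⇒≈ (x * 1ℝ) x λ n → ℚ.*-identityʳ (seq x n))
          ; distrib = (λ x y z → ≗⇒≈ (x * (y + z)) (x * y + x * z)
                        λ n → ℚ.*-distribˡ-+ (seq x n) (seq y n) (seq z n))
                    , (λ x y z → ≗⇒≈ ((y + z) * x) (y * x + z * x)
                        λ n → ℚ.*-distribʳ-+ (seq x n) (seq y n) (seq z n)) }
        ; zero = (λ x → ≗⇒≈ (0ℝ * x) 0ℝ λ n → ℚ.*-zeroˡ (seq x n))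
               , (λ x → ≗⇒≈ (x * 0ℝ) 0ℝ λ n → ℚ.*-zeroʳ (seq x n)) }
      ; *-comm = *-comm } }

  ≈⇒≤ : ∀ {x y} → x ≈ y → x ≤ y
  ≈⇒≤ {x} {y} x≈y ε 0<ε with x≈y ε 0<ε
  ... | N , close = N , λ n N≤n → begin
    seq x n                                  ≡⟨ subtract-add (seq x n) (seq y n) ⟩
    (seq x n ℚ.- seq y n) ℚ.+ seq y n        ≤⟨ ℚ.+-monoˡ-≤ (seq y n) (ℚ.≤-trans (p≤∣p∣ _) (close n N≤n)) ⟩
    ε ℚ.+ seq y n                            ≡⟨ ℚ.+-comm ε (seq y n) ⟩
    seq y n ℚ.+ ε                            ∎
    where
    open ℚ.≤-Reasoning
    p≤∣p∣ : ∀ p → p ℚ.≤ ∣ p ∣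
    p≤∣p∣ p with ℚ.≤-total 0ℚ p
    ... | inj₁ 0≤p = ℚ.≤-reflexive (≡.sym (ℚ.0≤p⇒∣p∣≡p 0≤p))
    ... | inj₂ p≤0 = ℚ.≤-trans p≤0 (ℚ.0≤∣p∣ p)

  ≤-trans : ∀ {x y z} → x ≤ y → y ≤ z → x ≤ z
  ≤-trans {x} {y} {z} x≤y y≤z ε 0<ε with x≤y _ (½ε>0 0<ε) | y≤z _ (½ε>0 0<ε)
  ... | M , below | N , below′ = M ℕ.⊔ N , λ n ≤n → begin
    seq x n                                  ≤⟨ below n (ℕ.m⊔n≤o⇒m≤o M N ≤n) ⟩
    seq y n ℚ.+ ε ℚ.* ½                      ≤⟨ ℚ.+-monoˡ-≤ (ε ℚ.* ½) (below′ n (ℕ.m⊔n≤o⇒n≤o M N ≤n)) ⟩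
    seq z n ℚ.+ ε ℚ.* ½ ℚ.+ ε ℚ.* ½          ≡⟨ ℚ.+-assoc (seq z n) (ε ℚ.* ½) (ε ℚ.* ½) ⟩
    seq z n ℚ.+ (ε ℚ.* ½ ℚ.+ ε ℚ.* ½)        ≡⟨ cong (seq z n ℚ.+_) (½ε+½ε ε) ⟩
    seq z n ℚ.+ ε                            ∎
    where open ℚ.≤-Reasoning

  +-mono-≤ : ∀ {x y u v} → x ≤ y → u ≤ v → x + u ≤ y + v
  +-mono-≤ {x} {y} {u} {v} x≤y u≤v ε 0<ε with x≤y _ (½ε>0 0<ε) | u≤v _ (½ε>0 0<ε)
  ... | M , below | N , below′ = M ℕ.⊔ N , λ n ≤n → begin
    seq x n ℚ.+ seq u n
      ≤⟨ ℚ.+-mono-≤ (below n (ℕ.m⊔n≤o⇒m≤o M N ≤n)) (below′ n (ℕ.m⊔n≤o⇒n≤o M N ≤n)) ⟩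
    (seq y n ℚ.+ ε ℚ.* ½) ℚ.+ (seq v n ℚ.+ ε ℚ.* ½)
      ≡⟨ interchange (seq y n) (ε ℚ.* ½) (seq v n) (ε ℚ.* ½) ⟩
    (seq y n ℚ.+ seq v n) ℚ.+ (ε ℚ.* ½ ℚ.+ ε ℚ.* ½)
      ≡⟨ cong (seq y n ℚ.+ seq v n ℚ.+_) (½ε+½ε ε) ⟩
    seq y n ℚ.+ seq v n ℚ.+ ε ∎
    where open ℚ.≤-Reasoning

  +-cancelˡ-≤ : ∀ x {y z} → x + y ≤ x + z → y ≤ z
  +-cancelˡ-≤ x {y} {z} x+y≤x+z ε 0<ε with x+y≤x+z ε 0<ε
  ... | N , below = N , λ n N≤n → ℚ-cancel (seq x n)
    (≡.subst (seq x n ℚ.+ seq y n ℚ.≤_) (ℚ.+-assoc (seq x n) (seq z n) ε) (below n N≤n))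
    where
    ℚ-cancel : ∀ p {q r} → p ℚ.+ q ℚ.≤ p ℚ.+ r → q ℚ.≤ r
    ℚ-cancel p p+q≤p+r = ℚ.≮⇒≥ λ r<q → ℚ.<-irrefl refl (ℚ.<-≤-trans (ℚ.+-monoʳ-< p r<q) p+q≤p+r)

  1≰0 : ¬ 1ℝ ≤ 0ℝ
  -- Tolerance ½ would give 1 ≤ ½ in `ℚ`.
  1≰0 1≤0 with 1≤0 ½ (ℚ.positive⁻¹ ½)
  ... | N , below = from-no (1ℚ ℚ.≤? 0ℚ ℚ.+ ½) (below N ℕ.≤-refl)

  ℝ-isOrdered : IsOrdered ℝ-commutativeSemiring _≤_
  ℝ-isOrdered = record
    { ≈⇒≤         = λ {x} {y} → ≈⇒≤ {x} {y}
    ; ≤-trans     = λ {x} {y} {z} → ≤-trans {x} {y} {z}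
    ; +-mono-≤    = λ {x} {y} {u} {v} → +-mono-≤ {x} {y} {u} {v}
    ; +-cancelˡ-≤ = λ x {y} {z} → +-cancelˡ-≤ x {y} {z}
    ; 0≤1         = λ ε 0<ε → 0 , λ _ _ → ℚ.+-mono-≤ (ℚ.nonNegative⁻¹ 1ℚ) (ℚ.<⇒≤ 0<ε)
    ; 1≰0         = 1≰0 }

-- Specialisation to the reals and the equivalences.

open RealNumbers using (ℝ-commutativeSemiring; ℝ-isOrdered)
open LinearAlgebra ℝ-commutativeSemiring Defs._≤_ ℝ-isOrdered

identity-isIdentity : ∀ n → IsIdentity (identity n)
identity-isIdentity n = record { diagonal = diagonal ; offDiagonal = offDiagonal }
  where
  open CommutativeSemiring ℝ-commutativeSemiring using (_≈_) renaming (refl to ≈-refl)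

  diagonal : ∀ i → identity n i i ≈ 1ℝ
  diagonal i with i Fin.≟ i
  ... | yes _   = ≈-refl {1ℝ}
  ... | no  i≢i = contradiction refl i≢i

  offDiagonal : ∀ {i j} → i ≢ j → identity n i j ≈ 0ℝ
  offDiagonal {i} {j} i≢j with i Fin.≟ j
  ... | yes i≡j = contradiction i≡j i≢j
  ... | no  _   = ≈-refl {0ℝ}

controllable⇒walkInverse : ∀ {n} (G : Graph n) → Controllable G → WalkInverse G
controllable⇒walkInverse {n} G (B , WB≈I , _) =
  walkInverse (walkMatrix G) (λ i k → ι-walks-power G (adjacencyMatrix G ^_) (identity-isIdentity n)
    -- The recursion of the powers holds by unfolding `_^_` and `_⊡_`.
    (λ k i j → CommutativeSemiring.refl ℝ-commutativeSemiring {(adjacencyMatrix G ^ suc k) i j}) (toℕ k) i)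
    (identity-isIdentity n) B WB≈I

-- The transpose of `S` is again doubly stochastic and intertwines in the opposite direction.
fractionallyIsomorphic⇒dominated : ∀ {m n} {G : Graph m} {H : Graph n} →
  FractionallyIsomorphic G H → WalksDominated G H × WalksDominated H G
fractionallyIsomorphic⇒dominated {G = G} (fractional {H} S ds SA≈BS) =
  fractional⇒dominated H G (flip S) (flip nonNegative) columnSum rowSum
    (transpose-intertwines G H S SA≈BS) ,
  fractional⇒dominated G H S nonNegative rowSum columnSum SA≈BS
  where open DoublyStochastic ds

≅⇒fractionallyIsomorphic : ∀ {m n} {G : Graph m} {H : Graph n} → G ≅ H → FractionallyIsomorphic G H
≅⇒fractionallyIsomorphic {m} {n} {G} {H} G≅H = permuted (↔⇒≡ (_≅_.bijection G≅H)) H G≅H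
  where
  -- `fractional` needs graphs on literally the same vertex set, so `H` is generalised before the
  -- equality of orders is matched.
  permuted : ∀ {n} → m ≡ n → (H : Graph n) → G ≅ H → FractionallyIsomorphic G H
  permuted refl H G≅H = fractional S
    (record { nonNegative = S≥0 ; rowSum = rowSum ; columnSum = columnSum })
    intertwines
    where
    isId = identity-isIdentity m
    open PermutationMatrix G≅H isId

corollary7 : ∀ {m n : ℕ} (G : Graph m) (H : Graph n) → Controllable G → Controllable H →
    (SameIteratedDegreeSequence G H ⇔ FractionallyIsomorphic G H) ×
    (FractionallyIsomorphic G H ⇔ C²-Equivalent G H) ×
    (C²-Equivalent G H ⇔ G ≅ H)
corollary7 G H controllableᴳ controllableᴴ =
  -- Implications among the first three conditions are composed through `G ≅ H`.
  mk⇔ (≅⇒fractionallyIsomorphic ∘ same⇒≅) (≅⇒sameIteratedDegrees ∘ fractional⇒≅) ,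
  mk⇔ (≅⇒C²-equivalent ∘ fractional⇒≅) (≅⇒fractionallyIsomorphic ∘ C²⇒≅) ,
  mk⇔ C²⇒≅ ≅⇒C²-equivalent
  where
  dominated⇒≅ : WalksDominated G H → WalksDominated H G → G ≅ H
  dominated⇒≅ = Isomorphism.G≅H
    (controllable⇒walkInverse G controllableᴳ) (controllable⇒walkInverse H controllableᴴ)

  same⇒≅ : SameIteratedDegreeSequence G H → G ≅ H
  same⇒≅ same = dominated⇒≅ (sameIteratedDegrees⇒dominated G H same)
    (sameIteratedDegrees⇒dominated H G λ r → Setoid.sym (iteratedMultisetSetoid (depth r)) (same r))

  fractional⇒≅ : FractionallyIsomorphic G H → G ≅ H
  fractional⇒≅ = uncurry dominated⇒≅ ∘ fractionallyIsomorphic⇒dominated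

  C²⇒≅ : C²-Equivalent G H → G ≅ H
  C²⇒≅ G≡H = dominated⇒≅ (C²-equivalent⇒dominated G H G≡H)
    (C²-equivalent⇒dominated H G λ φ closed → ⇔-sym (G≡H φ closed))
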